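{- Let $n\geq 3$, $q=\lfloor n/3\rfloor$ and $r=n-3q$. Suppose the preference order $\sigma\in\{\pm1\}^n$ is chosen uniformly at random (equivalently, each diner independently prefers left or right with probability $1/2$), and the ma\^{i}tre d' seats the diners using the clairvoyant trap setting strategy (Algorithm $\mathcal{C}$ described in the context). Then: (1) The probability that exactly $k$ diners are napkinless is $p_{n,k}/2^n$, where \[ p_{n,k}=\begin{cases} 4\binom{n}{k} & \text{if } 0\leq k<q,\\[2pt] 2^n-4\sum_{i=0}^{q-1}\binom{n}{i} & \text{if } k=q,\\[2pt] 0 & \text{otherwise.}\end{cases} \] (2) The expected number of napkinless diners is \[ E_n=q-\frac{1}{2^{n-2}}\sum_{k=0}^{q-1}(q-k)\binom{n}{k}, \] and $E_n\to \lfloor n/3\rfloor$ as $n\to\infty$ (in the sense that $E_n-\lfloor n/3\rfloor\to 0$). (3) The strategy is optimal: for every preference order $\sigma\in\{\pm1\}^n$, the number of napkinless diners in the arrangement produced by Algorithm $\mathcal{C}$ equals $\nu_{\max}(\sigma)$, the maximum number of napkinless diners over all seating orders.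
   Context: Napkin problem. A circular table has $n$ seats labelled $1,\dots,n$ (indices mod $n$), seat $i+1$ being immediately to the right of seat $i$. Between seats $i$ and $i+1$ lies napkin $N_i$, so the diner in seat $i$ has left napkin $N_{i-1}$ and right napkin $N_i$. Diners labelled $1,\dots,n$ are seated one at a time in the order $1,2,\dots,n$. A preference order is $\sigma=(\sigma_1,\dots,\sigma_n)\in\{\pm1\}^n$: $\sigma_j=+1$ means Diner $j$ prefers the right napkin, $\sigma_j=-1$ the left napkin. When Diner $j$ sits, they take their preferred napkin if it is unclaimed; otherwise they take their other adjacent napkin if unclaimed; otherwise they take no napkin and are called napkinless. A seating order is a permutation $w=(w_1,\dots,w_n)$ of $\{1,\dots,n\}$ with $w_1=1$, where $w_i=j$ means Diner $j$ sits in Seat $i$. $\nu(w,\sigma)$ denotes the number of napkinless diners, and $\nu_{\max}(\sigma)=\max_w \nu(w,\sigma)$. The ma\^{i}tre d' learns $\sigma_i$ only when Diner $i$ is about to be seated (after Diners $1,\dots,i-1$ have been placed). Algorithm $\mathcal{C}$ (clairvoyant trap setting). Write $n=3q+r$ with $q=\lfloor n/3\rfloor$. For $1\le j\le q$, bench $B_j$ consists of seats $3j-2$ (leftmost), $3j-1$ (centre), $3j$ (rightmost); seats $3q+1,\dots,n$ are remainder seats. At any stage a bench $B_j$ is primed if its leftmost and rightmost seats are assigned and its centre seat is not; each unassigned remainder seat also counts as a primed bench, ordered after $B_1,\dots,B_q$ and from left to right. For $i=1,\dots,n$, on learning $\sigma_i$: (1) if $\sigma_i=+1$: (a) if some bench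 has an unassigned leftmost seat, assign Diner $i$ to the leftmost seat of the lowest-numbered such bench; (b) else if a primed bench exists, assign Diner $i$ to the lowest-numbered primed bench (its centre seat, or the leftmost unassigned remainder seat if it is a remainder seat); (c) else assign Diner $i$ to the rightmost seat of the lowest-numbered bench possible. (2) if $\sigma_i=-1$: (a) if some bench has an unassigned rightmost seat, assign Diner $i$ to the rightmost seat of the lowest-numbered such bench; (b) else if a primed bench exists, assign Diner $i$ to the lowest-numbered primed bench (centre seat, or leftmost unassigned remainder seat); (c) else assign Diner $i$ to the leftmost seat of the lowest-numbered bench possible. The resulting assignment (with seat labels rotated so that Diner 1 is in Seat 1, which does not affect who is napkinless) is the seating produced by the strategy. -}

module Defs where

open import Data.Bool using (Bool; true; false; not; _∧_; if_then_else_)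
open import Data.Nat using (ℕ; zero; suc; _+_; _*_; _∸_; _^_; _≡ᵇ_; _<_; _≤_)
open import Data.Nat.DivMod using (_/_; _mod_)
open import Data.Nat.Combinatorics using (_C_)
open import Data.Fin using (Fin; toℕ)
open import Data.List using (List; []; _∷_; _++_; [_]; upTo; applyUpTo; filterᵇ; map; length; zip; tabulate; concatMap)
open import Data.Bool.ListAction using (any)
open import Data.Nat.ListAction using (sum)
open import Data.Maybe using (Maybe; just; nothing)
open import Data.Product using (Σ; _×_; _,_)
open import Data.Sign using (Sign) renaming (+ to prefR; - to prefL)
open import Data.Vec using (Vec) renaming ([] to []ᵛ; _∷_ to _∷ᵛ_)
import Data.Vec as Vec
open import Data.Fin.Permutation using (Permutation′; _⟨$⟩ʳ_; _⟨$⟩ˡ_)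
open import Relation.Binary.PropositionalEquality using (_≡_)

-- Conventions (0-indexed).  Seats 0,…,n-1 (paper's Seat i = our seat i-1),
-- diners 0,…,n-1 (paper's Diner j = our diner j-1), napkins 0,…,n-1.
-- Napkin k lies between seat k and seat k+1 (mod n): the diner in seat s
-- has right napkin s and left napkin s-1 (mod n).
-- A preference order is σ : Vec Sign n;  prefR (Sign +) = prefers right (+1),
-- prefL (Sign -) = prefers left (-1).

free : List ℕ → ℕ → Bool
free used x = not (any (λ y → y ≡ᵇ x) used)

first : (ℕ → Bool) → List ℕ → Maybe ℕ
first p []       = nothing
first p (x ∷ xs) = if p x then just x else first p xs

napkinlessGo : ℕ → List ℕ → List (Sign × ℕ) → ℕ
napkinlessGo n taken [] = 0
napkinlessGo n taken ((s , seat) ∷ rest) with prefOther s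
  where
  leftN : ℕ
  leftN = if seat ≡ᵇ 0 then n ∸ 1 else seat ∸ 1
  prefOther : Sign → ℕ × ℕ
  prefOther prefR = seat , leftN
  prefOther prefL = leftN , seat
... | (p , o) =
  if free taken p then napkinlessGo n (p ∷ taken) rest
  else if free taken o then napkinlessGo n (o ∷ taken) rest
  else suc (napkinlessGo n taken rest)

-- number of napkinless diners when diner j sits in seat (pos j),
-- diners being seated in the order 0,1,…,n-1
napkinless : (n : ℕ) → (Fin n → Fin n) → Vec Sign n → ℕ
napkinless n pos σ =
  napkinlessGo n [] (zip (Vec.toList σ) (tabulate (λ j → toℕ (pos j))))

-- Seating orders: permutations w with w ⟨$⟩ʳ seat = diner in that seat,
-- such that diner 0 (paper: Diner 1) sits in seat 0 (paper: Seat 1).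

SeatingOrder : ℕ → Set
SeatingOrder n = Σ (Permutation′ n) (λ w → ∀ (i : Fin n) → toℕ i ≡ 0 → toℕ (w ⟨$⟩ʳ i) ≡ 0)

seatingOrderPos : (n : ℕ) → SeatingOrder n → Fin n → Fin n
seatingOrderPos n (w , _) j = w ⟨$⟩ˡ j

ν : (n : ℕ) → SeatingOrder n → Vec Sign n → ℕ
ν n w σ = napkinless n (seatingOrderPos n w) σ

-- Algorithm C (clairvoyant trap setting).  q = ⌊n/3⌋; bench b (b < q)
-- has leftmost seat 3b, centre 3b+1, rightmost 3b+2; seats 3q,…,n-1 are
-- remainder seats.  `used` is the list of already assigned seats.

pick : Maybe ℕ → Maybe ℕ → Maybe ℕ → ℕ
pick (just x) _ _ = x
pick nothing (just x) _ = x
pick nothing nothing (just x) = x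
pick nothing nothing nothing = 0   -- never reached (n seats, n diners)

leftmostFree : ℕ → List ℕ → Maybe ℕ
leftmostFree n used = first (free used) (map (λ b → 3 * b) (upTo (n / 3)))

rightmostFree : ℕ → List ℕ → Maybe ℕ
rightmostFree n used = first (free used) (map (λ b → 3 * b + 2) (upTo (n / 3)))

-- seat of the lowest-numbered primed bench: centre seats of primed benches
-- B_b (in order of b), followed by the unassigned remainder seats (left to right)
primedSeat : ℕ → List ℕ → Maybe ℕ
primedSeat n used =
  first (λ _ → true)
    (map (λ b → 3 * b + 1)
       (filterᵇ (λ b → not (free used (3 * b)) ∧ not (free used (3 * b + 2)) ∧ free used (3 * b + 1))
                (upTo (n / 3)))
     ++ filterᵇ (free used) (applyUpTo (λ i → 3 * (n / 3) + i) (n ∸ 3 * (n / 3))))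

seatC : ℕ → List ℕ → Sign → ℕ
seatC n used prefR = pick (leftmostFree n used) (primedSeat n used) (rightmostFree n used)
seatC n used prefL = pick (rightmostFree n used) (primedSeat n used) (leftmostFree n used)

-- run the algorithm: the list of seats of diners 0,1,2,… in order
-- (the seat of diner i only depends on σ_0,…,σ_i)
runCGo : ℕ → List ℕ → List Sign → List ℕ
runCGo n used [] = used
runCGo n used (s ∷ ss) = runCGo n (used ++ [ seatC n used s ]) ss

runC : (n : ℕ) → Vec Sign n → List ℕ
runC n σ = runCGo n [] (Vec.toList σ)

nth : List ℕ → ℕ → ℕ
nth [] _ = 0
nth (x ∷ xs) zero = x
nth (x ∷ xs) (suc k) = nth xs k

-- reduce modulo n (the Fin n argument only witnesses n ≠ 0)
toFin : ∀ {n} → Fin n → ℕ → Fin n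
toFin {suc m} _ k = k mod suc m

-- the seating produced by algorithm C, rotated so that diner 0 is in seat 0
seatingC : (n : ℕ) → Vec Sign n → Fin n → Fin n
seatingC n σ j = toFin j (nth (runC n σ) (toℕ j) + n ∸ nth (runC n σ) 0)

νC : (n : ℕ) → Vec Sign n → ℕ
νC n σ = napkinless n (seatingC n σ) σ

allPrefs : (n : ℕ) → List (Vec Sign n)
allPrefs zero = []ᵛ ∷ []
allPrefs (suc n) = concatMap (λ v → (prefR ∷ᵛ v) ∷ (prefL ∷ᵛ v) ∷ []) (allPrefs n)

countC : ℕ → ℕ → ℕ
countC n k = length (filterᵇ (λ σ → νC n σ ≡ᵇ k) (allPrefs n))

Σ< : ℕ → (ℕ → ℕ) → ℕ
Σ< m f = sum (map f (upTo m))

-- total number of napkinless diners over all σ  (= 2^n · expected value)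
totalC : ℕ → ℕ
totalC n = sum (map (νC n) (allPrefs n))

-- 4 Σ_{k<q} (q-k) C(n,k),  q = ⌊n/3⌋;  E_n = q - defect n / 2^n
defect : ℕ → ℕ
defect n = 4 * Σ< (n / 3) (λ k → (n / 3 ∸ k) * (n C k))

{-# OPTIONS --safe #-}
module Submission where

-- Let S be the ±1 walk of preferences.  For k ≤ q, Algorithm C leaves fewer than k diners
-- napkinless iff S reaches ±(n + 1 − 2k) within n steps.
--
-- No seating does better.  To the right of a napkinless diner sits a run of diners holding
-- their left napkins, the last of whom preferred left; on the left, symmetrically, there is
-- one who preferred right.  These witnesses are distinct and seated earlier, so 3ν ≤ n.
-- If moreover, at some moment, preference d leads by h, then each napkinless diner is
-- charged either to one of the earlier diners of the other preference or to two later
-- diners, which gives 2ν + h ≤ n.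
--
-- Algorithm C does this well.  A bench fails to produce a napkinless diner only if one of
-- its sides is taken by a diner with the wrong preference, and at the last such event the
-- occupied seats show that S has reached the corresponding height.
--
-- The reflection principle counts the walks reaching a height, and reaching both h and −h
-- would take 3h > n steps; hence #{ν < k} = 4 Σ_{i<k} C(n,i), from which the distribution
-- and the expectation follow.

open import Defs
open import Data.Bool using (Bool; true; false; not; _∧_; if_then_else_; T)
open import Data.Bool.Properties using (∧-zeroʳ)
open import Data.Fin using (Fin; toℕ; punchOut)
open import Data.Fin.Patterns using (0F)
import Data.Fin.Properties as Fin
open import Data.Fin.Properties using (toℕ<n; toℕ-injective; toℕ-fromℕ<; any?; punchOut-injective; <⇒notInjective)
open import Data.Fin.Permutation using (permutation; _⟨$⟩ʳ_; inverseʳ)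
open import Data.List using (List; []; _∷_; _++_; [_]; upTo; applyUpTo; filterᵇ; map; length; concatMap; zip; tabulate)
open import Data.List.Properties using (map-++; upTo-∷ʳ; map-upTo; map-applyUpTo; length-tabulate; tabulate-cong; ++-assoc; ++-identityʳ)
open import Data.List.Relation.Unary.All as All using (All; []; _∷_)
import Data.List.Relation.Unary.All.Properties as All
open import Data.List.Relation.Unary.AllPairs using ([]; _∷_)
open import Data.List.Relation.Unary.Unique.Propositional using (Unique)
import Data.List.Relation.Unary.Unique.Propositional.Properties as Unique
open import Data.Maybe using (Maybe; just; nothing)
open import Data.Nat
open import Data.Nat.Combinatorics using (_C_; nCk+nC[k+1]≡[n+1]C[k+1]; k>n⇒nCk≡0)
open import Data.Nat.DivMod using (_/_; _%_; m/n*n≤m; m≡m%n+[m/n]*n; [m+kn]%n≡m%n; [m+n]%n≡m%n; m<n⇒m%n≡m; n%n≡0; m%n<n; %-distribˡ-+; m%n%n≡m%n)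
open import Data.Nat.ListAction using (sum)
open import Data.Nat.ListAction.Properties using (sum-++)
open import Data.Nat.Properties
open import Data.Nat.Tactic.RingSolver using (solve-∀)
open import Data.Product using (Σ; _×_; _,_; ∃; ∃₂; proj₁; proj₂)
open import Data.Sign using (Sign; opposite) renaming (+ to prefR; - to prefL)
import Data.Sign.Properties as Sign
open import Data.Sum using (_⊎_; inj₁; inj₂)
open import Data.Vec using (Vec; toList) renaming (_∷_ to _∷ᵛ_)
open import Data.Vec.Properties using (length-toList)
open import Function using (_∘_)
open import Function.Definitions using (Injective)
open import Relation.Nullary using (¬_; Dec; yes; no; contradiction)
open import Relation.Nullary.Decidable using (map′)
open import Relation.Binary.PropositionalEquality using (_≡_; _≢_; refl; sym; trans; cong; cong₂; subst; subst₂; module ≡-Reasoning)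

-- Why the height n + 1 - 2k: by parity no walk of n steps ends there, so by reflection the walks
-- reaching it are twice those ending above it, and the latter have fewer than k steps against them.
-- This is one factor 2 of the 4; the sign of the height is the other.
--
-- Why spoilt benches force a height: a bench is spoilt only when the spoiler's own side kind is
-- full and the other kind is not, so all spoilt benches are due to one preference d. Let there be 1
-- + v of them, and let x diners of the other preference have come by the last. These x sit at their
-- own sides, so the d-diners occupy q own sides, r remainder seats, x + v centres and 1 + v wrong
-- sides: they lead by q + r + 2v + 1. As n = 3q + r, the bound 2ν + h ≤ n turns this lead into ν ≤
-- q - 1 - v for every seating, which is what Algorithm C guarantees.
--
-- Witnesses of a napkinless diner are awkward to trace around a circle. Instead, an inequality
-- between neighbouring seats is kept invariant and summed round the table, and the charging becomes
-- a potential, bounded by induction on the diners still to come.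

-- Sums, binomial coefficients and walks

-- Certificate for a linear inequality a ≤ b: a hypothesis x ≤ y and a slack s.
linear : ∀ {a b x y} s → x ≤ y → a + y + s ≡ b + x → a ≤ b
linear {a} {b} {x} {y} s x≤y eq = +-cancelʳ-≤ x a b (begin
  a + x      ≤⟨ +-monoʳ-≤ a x≤y ⟩
  a + y      ≤⟨ m≤m+n (a + y) s ⟩
  a + y + s  ≡⟨ eq ⟩
  b + x      ∎)
  where open ≤-Reasoning

Σ<-suc : ∀ m f → Σ< (suc m) f ≡ Σ< m f + f m
Σ<-suc m f = begin
  sum (map f (upTo (suc m)))       ≡⟨ cong (sum ∘ map f) (upTo-∷ʳ m) ⟨
  sum (map f (upTo m ++ [ m ]))    ≡⟨ cong sum (map-++ f (upTo m) [ m ]) ⟩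
  sum (map f (upTo m) ++ [ f m ])  ≡⟨ sum-++ (map f (upTo m)) [ f m ] ⟩
  Σ< m f + (f m + 0)               ≡⟨ cong (Σ< m f +_) (+-identityʳ (f m)) ⟩
  Σ< m f + f m                     ∎
  where open ≡-Reasoning

Σ<-cons : ∀ m f → Σ< (suc m) f ≡ f 0 + Σ< m (f ∘ suc)
Σ<-cons m f = cong (λ xs → f 0 + sum xs)
  (trans (map-applyUpTo suc f m) (sym (map-upTo (f ∘ suc) m)))

Σ<-mono : ∀ m {f g} → (∀ i → i < m → f i ≤ g i) → Σ< m f ≤ Σ< m g
Σ<-mono zero    _ = z≤n
Σ<-mono (suc m) {f} {g} h rewrite Σ<-suc m f | Σ<-suc m g =
  +-mono-≤ (Σ<-mono m λ i i<m → h i (m<n⇒m<1+n i<m)) (h m ≤-refl)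

Σ<-cong : ∀ m {f g} → (∀ i → i < m → f i ≡ g i) → Σ< m f ≡ Σ< m g
Σ<-cong m h = ≤-antisym (Σ<-mono m λ i i<m → ≤-reflexive (h i i<m))
                        (Σ<-mono m λ i i<m → ≤-reflexive (sym (h i i<m)))

Σ<-+ : ∀ m f g → Σ< m (λ i → f i + g i) ≡ Σ< m f + Σ< m g
Σ<-+ zero    f g = refl
Σ<-+ (suc m) f g rewrite Σ<-suc m (λ i → f i + g i) | Σ<-suc m f | Σ<-suc m g | Σ<-+ m f g =
  rearrange (Σ< m f) (Σ< m g) (f m) (g m)
  where
  rearrange : ∀ a b c d → a + b + (c + d) ≡ a + c + (b + d)
  rearrange = solve-∀

Σ<-const : ∀ m c → Σ< m (λ _ → c) ≡ m * c
Σ<-const zero    c = refl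
Σ<-const (suc m) c = trans (Σ<-suc m _) (trans (cong (_+ c) (Σ<-const m c)) (+-comm (m * c) c))

bsum : ℕ → ℕ → ℕ
bsum n k = Σ< k (n C_)

bsum-suc : ∀ n k → bsum n (suc k) ≡ bsum n k + n C k
bsum-suc n k = Σ<-suc k (n C_)

bsum-pascal : ∀ n k → bsum (suc n) (suc k) ≡ bsum n (suc k) + bsum n k
bsum-pascal n zero = refl
bsum-pascal n (suc k) = begin
  bsum (suc n) (2 + k)
    ≡⟨ bsum-suc (suc n) (suc k) ⟩
  bsum (suc n) (suc k) + suc n C suc k
    ≡⟨ cong₂ _+_ (bsum-pascal n k) (sym (nCk+nC[k+1]≡[n+1]C[k+1] n k)) ⟩
  (bsum n (suc k) + bsum n k) + (n C k + n C suc k)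
    ≡⟨ rearrange (bsum n (suc k)) (bsum n k) (n C k) (n C suc k) ⟩
  (bsum n (suc k) + n C suc k) + (bsum n k + n C k)
    ≡⟨ cong₂ _+_ (bsum-suc n (suc k)) (bsum-suc n k) ⟨
  bsum n (2 + k) + bsum n (suc k) ∎
  where
  open ≡-Reasoning
  rearrange : ∀ a b c d → (a + b) + (c + d) ≡ (a + d) + (b + c)
  rearrange = solve-∀

bsum-row : ∀ n → bsum n (suc n) ≡ 2 ^ n
bsum-row zero = refl
bsum-row (suc n) = begin
  bsum (suc n) (2 + n)
    ≡⟨ bsum-pascal n (suc n) ⟩
  bsum n (2 + n) + bsum n (suc n)
    ≡⟨ cong (_+ bsum n (suc n)) (bsum-suc n (suc n)) ⟩
  bsum n (suc n) + n C suc n + bsum n (suc n)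
    ≡⟨ cong (λ c → bsum n (suc n) + c + bsum n (suc n)) (k>n⇒nCk≡0 (n<1+n n)) ⟩
  bsum n (suc n) + 0 + bsum n (suc n)
    ≡⟨ rearrange (bsum n (suc n)) ⟩
  2 * bsum n (suc n)
    ≡⟨ cong (2 *_) (bsum-row n) ⟩
  2 ^ suc n ∎
  where
  open ≡-Reasoning
  rearrange : ∀ a → a + 0 + a ≡ 2 * a
  rearrange = solve-∀

-- By the symmetry of the row, its entries from index `k` on have the sum of its first `l`. Pascal's
-- rule proves this complementary form directly, with the row sum as boundary case.
bsum-complement : ∀ n k l → k + l ≡ suc n → bsum n k + bsum n l ≡ 2 ^ n
bsum-complement n zero l refl = bsum-row n
bsum-complement n (suc k) zero eq = begin
  bsum n (suc k) + 0  ≡⟨ +-identityʳ _ ⟩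
  bsum n (suc k)      ≡⟨ cong (bsum n) (trans (sym (+-identityʳ (suc k))) eq) ⟩
  bsum n (suc n)      ≡⟨ bsum-row n ⟩
  2 ^ n               ∎
  where open ≡-Reasoning
bsum-complement zero (suc k) (suc l) eq = contradiction (trans (sym (+-suc k l)) (suc-injective eq)) λ ()
bsum-complement (suc n) (suc k) (suc l) eq = begin
  bsum (suc n) (suc k) + bsum (suc n) (suc l)
    ≡⟨ cong₂ _+_ (bsum-pascal n k) (bsum-pascal n l) ⟩
  bsum n (suc k) + bsum n k + (bsum n (suc l) + bsum n l)
    ≡⟨ rearrange (bsum n (suc k)) (bsum n k) (bsum n (suc l)) (bsum n l) ⟩
  (bsum n (suc k) + bsum n l) + (bsum n k + bsum n (suc l))
    ≡⟨ cong₂ _+_ (bsum-complement n (suc k) l (trans (sym (+-suc k l)) (suc-injective eq)))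
                 (bsum-complement n k (suc l) (suc-injective eq)) ⟩
  2 ^ n + 2 ^ n
    ≡⟨ cong (2 ^ n +_) (+-identityʳ _) ⟨
  2 ^ suc n ∎
  where
  open ≡-Reasoning
  rearrange : ∀ a b c d → a + b + (c + d) ≡ (a + d) + (b + c)
  rearrange = solve-∀

bit : Bool → ℕ
bit true  = 1
bit false = 0

total : ∀ {A : Set} → (A → ℕ) → List A → ℕ
total f xs = sum (map f xs)

total-cong : ∀ {A : Set} {f g : A → ℕ} → (∀ x → f x ≡ g x) → ∀ xs → total f xs ≡ total g xs
total-cong h []       = refl
total-cong h (x ∷ xs) = cong₂ _+_ (h x) (total-cong h xs)

total-+ : ∀ {A : Set} (f g : A → ℕ) xs → total (λ x → f x + g x) xs ≡ total f xs + total g xs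
total-+ f g []       = refl
total-+ f g (x ∷ xs) rewrite total-+ f g xs = rearrange (f x) (g x) (total f xs) (total g xs)
  where
  rearrange : ∀ a b c d → a + b + (c + d) ≡ a + c + (b + d)
  rearrange = solve-∀

total-const : ∀ {A : Set} c (xs : List A) → total (λ _ → c) xs ≡ c * length xs
total-const c []       = sym (*-zeroʳ c)
total-const c (x ∷ xs) = trans (cong (c +_) (total-const c xs)) (sym (*-suc c (length xs)))

total-Σ< : ∀ {A : Set} m (f : ℕ → A → ℕ) xs →
           total (λ x → Σ< m (λ k → f k x)) xs ≡ Σ< m (λ k → total (f k) xs)
total-Σ< zero    f xs = total-const 0 xs
total-Σ< (suc m) f xs = begin
  total (λ x → Σ< (suc m) (λ k → f k x)) xs      ≡⟨ total-cong (λ x → Σ<-suc m (λ k → f k x)) xs ⟩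
  total (λ x → Σ< m (λ k → f k x) + f m x) xs    ≡⟨ total-+ _ (f m) xs ⟩
  total (λ x → Σ< m (λ k → f k x)) xs + total (f m) xs
    ≡⟨ cong (_+ total (f m) xs) (total-Σ< m f xs) ⟩
  Σ< m (λ k → total (f k) xs) + total (f m) xs   ≡⟨ Σ<-suc m _ ⟨
  Σ< (suc m) (λ k → total (f k) xs)              ∎
  where open ≡-Reasoning

length-filterᵇ : ∀ {A : Set} (p : A → Bool) xs → length (filterᵇ p xs) ≡ total (bit ∘ p) xs
length-filterᵇ p [] = refl
length-filterᵇ p (x ∷ xs) with p x
... | true  = cong suc (length-filterᵇ p xs)
... | false = length-filterᵇ p xs

total-allPrefs : ∀ n (f : Vec Sign (suc n) → ℕ) → total f (allPrefs (suc n)) ≡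
                 total (λ σ → f (prefR ∷ᵛ σ)) (allPrefs n) + total (λ σ → f (prefL ∷ᵛ σ)) (allPrefs n)
total-allPrefs n f = go (allPrefs n)
  where
  rearrange : ∀ a b c d → a + (b + (c + d)) ≡ a + c + (b + d)
  rearrange = solve-∀
  go : ∀ vs → total f (concatMap (λ v → (prefR ∷ᵛ v) ∷ (prefL ∷ᵛ v) ∷ []) vs) ≡
              total (λ σ → f (prefR ∷ᵛ σ)) vs + total (λ σ → f (prefL ∷ᵛ σ)) vs
  go []       = refl
  go (v ∷ vs) rewrite go vs = rearrange (f (prefR ∷ᵛ v)) (f (prefL ∷ᵛ v)) _ _

length-allPrefs : ∀ n → length (allPrefs n) ≡ 2 ^ n
length-allPrefs n = trans (sym (trans (total-const 1 (allPrefs n)) (*-identityˡ _))) (go n)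
  where
  go : ∀ n → total (λ _ → 1) (allPrefs n) ≡ 2 ^ n
  go zero = refl
  go (suc n) rewrite total-allPrefs n (λ _ → 1) | go n = cong (2 ^ n +_) (sym (+-identityʳ _))

-- hit d h σ: the walk that steps +1 on preference d and −1 on the opposite
-- preference reaches height h.
hit : Sign → ℕ → List Sign → Bool
hit d zero    ss = true
hit d (suc h) [] = false
hit prefR (suc h) (prefR ∷ ss) = hit prefR h ss
hit prefR (suc h) (prefL ∷ ss) = hit prefR (2 + h) ss
hit prefL (suc h) (prefL ∷ ss) = hit prefL h ss
hit prefL (suc h) (prefR ∷ ss) = hit prefL (2 + h) ss

hit-same : ∀ d h ss → hit d (suc h) (d ∷ ss) ≡ hit d h ss
hit-same prefR h ss = refl
hit-same prefL h ss = refl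

hit-opposite : ∀ d h ss → hit d (suc h) (opposite d ∷ ss) ≡ hit d (2 + h) ss
hit-opposite prefR h ss = refl
hit-opposite prefL h ss = refl

-- Matching on this view keeps `d` abstract, so that mirror-image arguments are given once;
-- `hit-same` and `hit-opposite` supply the reductions that are then blocked.
data Relative (d : Sign) : Sign → Set where
  same : Relative d d
  opp  : Relative d (opposite d)

relative : ∀ d s → Relative d s
relative prefR prefR = same
relative prefR prefL = opp
relative prefL prefR = opp
relative prefL prefL = same

both-signs : (P : Sign → Set) → ∀ d → P d → P (opposite d) → ∀ e → P e
both-signs P d p p′ e with relative d e
... | same = p
... | opp  = p′

hit⇒≤length : ∀ d h ss → hit d h ss ≡ true → h ≤ length ss
hit⇒≤length d zero    ss       _ = z≤n
hit⇒≤length d (suc h) (s ∷ ss) p with relative d s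
... | same = s≤s (hit⇒≤length d h ss (trans (sym (hit-same d h ss)) p))
... | opp  = m≤n⇒m≤1+n (≤-trans (n≤1+n (suc h))
               (hit⇒≤length d (2 + h) ss (trans (sym (hit-opposite d h ss)) p)))

hit-mono : ∀ d {h h′} ss → h ≤ h′ → hit d h′ ss ≡ true → hit d h ss ≡ true
hit-mono d ss z≤n _ = refl
hit-mono d (s ∷ ss) (s≤s {h} {h′} h≤h′) p with relative d s
... | same = trans (hit-same d h ss)
               (hit-mono d ss h≤h′ (trans (sym (hit-same d h′ ss)) p))
... | opp  = trans (hit-opposite d h ss)
               (hit-mono d ss (s≤s (s≤s h≤h′)) (trans (sym (hit-opposite d h′ ss)) p))

-- A walk visiting both a and −b must retrace its way to the first of them.
hit-both : ∀ a b ss → hit prefR a ss ≡ true → hit prefL b ss ≡ true →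
           (2 * a + b ≤ length ss) ⊎ (a + 2 * b ≤ length ss)
hit-both zero b ss p q = inj₁ (hit⇒≤length prefL b ss q)
hit-both (suc a) zero ss p q = inj₂ (subst (_≤ length ss) (sym (+-identityʳ (suc a)))
                                      (hit⇒≤length prefR (suc a) ss p))
hit-both (suc a) (suc b) (prefR ∷ ss) p q with hit-both a (2 + b) ss p q
... | inj₁ le = inj₁ (linear 0 le (eq a b (length ss)))
  where
  eq : ∀ a b l → 2 * (suc a) + suc b + l + 0 ≡ suc l + (2 * a + (2 + b))
  eq = solve-∀
... | inj₂ le = inj₂ (linear 2 le (eq a b (length ss)))
  where
  eq : ∀ a b l → suc a + 2 * suc b + l + 2 ≡ suc l + (a + 2 * (2 + b))
  eq = solve-∀
hit-both (suc a) (suc b) (prefL ∷ ss) p q with hit-both (2 + a) b ss p q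
... | inj₁ le = inj₁ (linear 2 le (eq a b (length ss)))
  where
  eq : ∀ a b l → 2 * (suc a) + suc b + l + 2 ≡ suc l + (2 * (2 + a) + b)
  eq = solve-∀
... | inj₂ le = inj₂ (linear 0 le (eq a b (length ss)))
  where
  eq : ∀ a b l → suc a + 2 * suc b + l + 0 ≡ suc l + (2 + a + 2 * b)
  eq = solve-∀

hitCount : Sign → ℕ → ℕ → ℕ
hitCount d n h = total (λ σ → bit (hit d h (toList σ))) (allPrefs n)

hitCount-zero : ∀ d n → hitCount d n 0 ≡ 2 ^ n
hitCount-zero d n = trans (total-const 1 (allPrefs n)) (trans (*-identityˡ _) (length-allPrefs n))

hitCount-suc : ∀ d n h → hitCount d (suc n) (suc h) ≡ hitCount d n h + hitCount d n (2 + h)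
hitCount-suc prefR n h = total-allPrefs n _
hitCount-suc prefL n h = trans (total-allPrefs n _) (+-comm (hitCount prefL n (2 + h)) _)

hitCount-far : ∀ d n h → n < h → hitCount d n h ≡ 0
hitCount-far d zero    (suc h) _ = refl
hitCount-far d (suc n) (suc h) (s≤s n<h) = trans (hitCount-suc d n h)
  (cong₂ _+_ (hitCount-far d n h n<h) (hitCount-far d n (2 + h) (m<n⇒m<1+n (m<n⇒m<1+n n<h))))

-- Reflection principle.
hitCount-bsum : ∀ d n h k → 2 * k + h ≡ suc n → hitCount d n h ≡ 2 * bsum n k
-- Every walk reaches height 0, and here n + 1 = 2k, so the first `k` entries make up exactly half
-- of the row.
hitCount-bsum d n zero k eq = trans (hitCount-zero d n)
  (trans (sym (bsum-complement n k k (trans (double k) eq))) (cong (bsum n k +_) (sym (+-identityʳ _))))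
  where
  double : ∀ k → k + k ≡ 2 * k + 0
  double = solve-∀
hitCount-bsum d n (suc h) zero refl = hitCount-far d n (suc n) ≤-refl
hitCount-bsum d zero (suc h) (suc k) eq = contradiction (trans (sym (shape k h)) eq) λ ()
  where
  shape : ∀ k h → 2 * suc k + suc h ≡ suc (suc (suc (2 * k + h)))
  shape = solve-∀
hitCount-bsum d (suc n) (suc h) (suc k) eq = begin
  hitCount d (suc n) (suc h)
    ≡⟨ hitCount-suc d n h ⟩
  hitCount d n h + hitCount d n (2 + h)
    ≡⟨ cong₂ _+_ (hitCount-bsum d n h (suc k) eq₁) (hitCount-bsum d n (2 + h) k (trans (shape k h) eq₁)) ⟩
  2 * bsum n (suc k) + 2 * bsum n k
    ≡⟨ *-distribˡ-+ 2 (bsum n (suc k)) (bsum n k) ⟨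
  2 * (bsum n (suc k) + bsum n k)
    ≡⟨ cong (2 *_) (bsum-pascal n k) ⟨
  2 * bsum (suc n) (suc k) ∎
  where
  open ≡-Reasoning
  eq₁ : 2 * suc k + h ≡ suc n
  eq₁ = suc-injective (trans (sym (+-suc (2 * suc k) h)) eq)
  shape : ∀ k h → 2 * k + (2 + h) ≡ 2 * suc k + h
  shape = solve-∀

-- The defect tends to zero

-- The absorption identity (k + 1) C(n,k+1) = (n - k) C(n,k), with the subtracted term moved across
-- to keep truncated subtraction out.
C-absorb : ∀ n k → suc k * (n C suc k) + k * (n C k) ≡ n * (n C k)
C-absorb zero    zero    = refl
C-absorb zero    (suc k) = cong₂ _+_ (*-zeroʳ (2 + k)) (*-zeroʳ (suc k))
C-absorb (suc n) zero    = begin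
  1 * (suc n C 1) + 0          ≡⟨ cong (λ c → 1 * c + 0) (nCk+nC[k+1]≡[n+1]C[k+1] n 0) ⟨
  1 * (1 + n C 1) + 0          ≡⟨ cong suc (rearrange (n C 1)) ⟩
  suc (1 * (n C 1) + 0)        ≡⟨ cong suc (C-absorb n zero) ⟩
  suc n * 1                    ∎
  where
  open ≡-Reasoning
  rearrange : ∀ a → a + 0 + 0 ≡ 1 * a + 0
  rearrange = solve-∀
C-absorb (suc n) (suc k) = begin
  (2 + k) * (suc n C (2 + k)) + suc k * (suc n C suc k)
    ≡⟨ cong₂ (λ x y → (2 + k) * x + suc k * y)
         (nCk+nC[k+1]≡[n+1]C[k+1] n (suc k)) (nCk+nC[k+1]≡[n+1]C[k+1] n k) ⟨
  (2 + k) * (b + c) + suc k * (a + b)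
    ≡⟨ split k a b c ⟩
  ((2 + k) * c + suc k * b) + (suc k * b + k * a) + (a + b)
    ≡⟨ cong₂ (λ x y → x + y + (a + b)) (C-absorb n (suc k)) (C-absorb n k) ⟩
  n * b + n * a + (a + b)
    ≡⟨ merge n a b ⟩
  suc n * (a + b)
    ≡⟨ cong (suc n *_) (nCk+nC[k+1]≡[n+1]C[k+1] n k) ⟩
  suc n * (suc n C suc k) ∎
  where
  open ≡-Reasoning
  a = n C k
  b = n C suc k
  c = n C (2 + k)
  split : ∀ k a b c → (2 + k) * (b + c) + suc k * (a + b) ≡
                      ((2 + k) * c + suc k * b) + (suc k * b + k * a) + (a + b)
  split = solve-∀
  merge : ∀ n a b → n * b + n * a + (a + b) ≡ suc n * (a + b)
  merge = solve-∀

-- Consecutive entries have ratio (n - k)/(k + 1), and the hypothesis makes this at least `r`: 1 up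
-- to the middle of the row, 2 up to its first third.
C-ratio : ∀ r n k → k + suc k * r ≤ n → r * (n C k) ≤ n C suc k
C-ratio r n k le = *-cancelˡ-≤ (suc k) (+-cancelʳ-≤ (k * c) _ _ (begin
  suc k * (r * c) + k * c        ≡⟨ rearrange k r c ⟩
  (k + suc k * r) * c            ≤⟨ *-monoˡ-≤ c le ⟩
  n * c                          ≡⟨ C-absorb n k ⟨
  suc k * (n C suc k) + k * c    ∎))
  where
  open ≤-Reasoning
  c = n C k
  rearrange : ∀ k r c → suc k * (r * c) + k * c ≡ (k + suc k * r) * c
  rearrange = solve-∀

C-mono : ∀ n k j → 2 * (k + j) ≤ n → n C k ≤ n C (k + j)
C-mono n k zero    le = ≤-reflexive (cong (n C_) (sym (+-identityʳ k)))
C-mono n k (suc j) le = begin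
  n C k              ≤⟨ C-mono n k j (linear 2 le (eq₁ k j n)) ⟩
  n C (k + j)        ≡⟨ *-identityˡ _ ⟨
  1 * (n C (k + j))  ≤⟨ C-ratio 1 n (k + j) (linear 1 le (eq₂ k j n)) ⟩
  n C suc (k + j)    ≡⟨ cong (n C_) (+-suc k j) ⟨
  n C (k + suc j)    ∎
  where
  open ≤-Reasoning
  eq₁ : ∀ k j n → 2 * (k + j) + n + 2 ≡ n + 2 * (k + suc j)
  eq₁ = solve-∀
  eq₂ : ∀ k j n → k + j + suc (k + j) * 1 + n + 1 ≡ n + 2 * (k + suc j)
  eq₂ = solve-∀

-- In the first third of the row each entry is at least twice its predecessor, so, as in a geometric
-- series, an entry dominates all earlier ones together.
bsum≤C : ∀ n j → 3 * j ≤ n → bsum n j ≤ n C j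
bsum≤C n zero    _  = z≤n
bsum≤C n (suc j) le = begin
  bsum n (suc j)       ≡⟨ bsum-suc n j ⟩
  bsum n j + n C j     ≤⟨ +-monoˡ-≤ (n C j) (bsum≤C n j (linear 3 le (eq₁ j n))) ⟩
  n C j + n C j        ≡⟨ cong (n C j +_) (+-identityʳ (n C j)) ⟨
  2 * (n C j)          ≤⟨ C-ratio 2 n j (linear 1 le (eq₂ j n)) ⟩
  n C suc j            ∎
  where
  open ≤-Reasoning
  eq₁ : ∀ j n → 3 * j + n + 3 ≡ n + 3 * suc j
  eq₁ = solve-∀
  eq₂ : ∀ j n → j + suc j * 2 + n + 1 ≡ n + 3 * suc j
  eq₂ = solve-∀

-- `f k` occurs in the partial sums with k ≤ j < q, hence q - k times. The defect thus becomes a sum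
-- of cumulative counts, the form needed in `totalC-defect`.
Σ<-weighted : ∀ q f → Σ< q (λ k → (q ∸ k) * f k) ≡ Σ< q (λ j → Σ< (suc j) f)
Σ<-weighted zero    f = refl
Σ<-weighted (suc q) f = begin
  Σ< (suc q) (λ k → (suc q ∸ k) * f k)
    ≡⟨ Σ<-suc q _ ⟩
  Σ< q (λ k → (suc q ∸ k) * f k) + (suc q ∸ q) * f q
    ≡⟨ cong₂ _+_ (Σ<-cong q step) (trans (cong (_* f q) (m+n∸n≡m 1 q)) (+-identityʳ (f q))) ⟩
  Σ< q (λ k → (q ∸ k) * f k + f k) + f q
    ≡⟨ cong (_+ f q) (Σ<-+ q _ f) ⟩
  Σ< q (λ k → (q ∸ k) * f k) + Σ< q f + f q
    ≡⟨ +-assoc _ (Σ< q f) (f q) ⟩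
  Σ< q (λ k → (q ∸ k) * f k) + (Σ< q f + f q)
    ≡⟨ cong₂ _+_ (Σ<-weighted q f) (sym (Σ<-suc q f)) ⟩
  Σ< q (λ j → Σ< (suc j) f) + Σ< (suc q) f
    ≡⟨ Σ<-suc q _ ⟨
  Σ< (suc q) (λ j → Σ< (suc j) f) ∎
  where
  open ≡-Reasoning
  step : ∀ k → k < q → (suc q ∸ k) * f k ≡ (q ∸ k) * f k + f k
  step k k<q = trans (cong (_* f k) (+-∸-assoc 1 (<⇒≤ k<q))) (+-comm (f k) _)

defect-bsum : ∀ n → defect n ≡ 4 * Σ< (n / 3) (λ j → bsum n (suc j))
defect-bsum n = cong (4 *_) (Σ<-weighted (n / 3) (n C_))

3*[n/3]≤n : ∀ n → 3 * (n / 3) ≤ n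
3*[n/3]≤n n = subst (_≤ n) (*-comm (n / 3) 3) (m/n*n≤m n 3)

-- Geometric domination is used twice, on each partial sum and on the sum of the resulting bounds;
-- two copies of the last entry remain under the factor 4.
defect≤8*C : ∀ n → defect n ≤ 8 * (n C (n / 3))
defect≤8*C n = begin
  defect n                              ≡⟨ defect-bsum n ⟩
  4 * Σ< q (λ j → bsum n (suc j))       ≤⟨ *-monoʳ-≤ 4 (Σ<-mono q λ j j<q → bsum≤C n (suc j)
                                             (≤-trans (*-monoʳ-≤ 3 j<q) (3*[n/3]≤n n))) ⟩
  4 * Σ< q (λ j → n C suc j)            ≤⟨ *-monoʳ-≤ 4 (n≤1+n _) ⟩
  4 * (n C 0 + Σ< q (λ j → n C suc j))  ≡⟨ cong (4 *_) (Σ<-cons q (n C_)) ⟨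
  4 * bsum n (suc q)                    ≡⟨ cong (4 *_) (bsum-suc n q) ⟩
  4 * (bsum n q + n C q)                ≤⟨ *-monoʳ-≤ 4 (+-monoˡ-≤ (n C q) (bsum≤C n q (3*[n/3]≤n n))) ⟩
  4 * (n C q + n C q)                   ≡⟨ rearrange (n C q) ⟩
  8 * (n C q)                           ∎
  where
  open ≤-Reasoning
  q = n / 3
  rearrange : ∀ c → 4 * (c + c) ≡ 8 * c
  rearrange = solve-∀

*C≤bsum : ∀ n k t → 2 * (k + t) ≤ n → t * (n C k) ≤ bsum n (k + t)
*C≤bsum n k zero    le = z≤n
*C≤bsum n k (suc t) le = begin
  n C k + t * (n C k)            ≤⟨ +-mono-≤ (C-mono n k t le′) (*C≤bsum n k t le′) ⟩
  n C (k + t) + bsum n (k + t)   ≡⟨ +-comm (n C (k + t)) _ ⟩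
  bsum n (k + t) + n C (k + t)   ≡⟨ bsum-suc n (k + t) ⟨
  bsum n (suc (k + t))           ≡⟨ cong (bsum n) (+-suc k t) ⟨
  bsum n (k + suc t)             ∎
  where
  open ≤-Reasoning
  eq : ∀ k t n → 2 * (k + t) + n + 2 ≡ n + 2 * (k + suc t)
  eq = solve-∀
  le′ : 2 * (k + t) ≤ n
  le′ = linear 2 le (eq k t n)

bsum≤2^ : ∀ n k → k ≤ n → bsum n k ≤ 2 ^ n
bsum≤2^ n k k≤n = subst (bsum n k ≤_)
  (bsum-complement n k (suc n ∸ k) (m+[n∸m]≡n (m≤n⇒m≤1+n k≤n))) (m≤m+n (bsum n k) _)

-- The binomial row still increases on [n/3, n/2], which has about n/6 entries, so
-- (n/6) · C(n,n/3) ≤ 2ⁿ.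
defect-limit : (m : ℕ) → ∃ λ N → (n : ℕ) → N ≤ n → suc m * defect n < 2 ^ n
defect-limit m = 6 * t , bound
  where
  -- One more than the coefficient of `c` to be beaten, which gives strictness because `c` is at
  -- least C(n,0) = 1; and 6t ≤ n together with 3q ≤ n puts q + t at or below n/2.
  t = suc (8 * suc m)
  bound : ∀ n → 6 * t ≤ n → suc m * defect n < 2 ^ n
  bound n 6t≤n = begin-strict
    suc m * defect n           ≤⟨ *-monoʳ-≤ (suc m) (defect≤8*C n) ⟩
    suc m * (8 * c)            ≡⟨ rearrange (suc m) c ⟩
    8 * suc m * c              <⟨ m<n+m (8 * suc m * c) (C-mono n 0 q (≤-trans (*-monoʳ-≤ 2 (m≤m+n q t)) half)) ⟩
    c + 8 * suc m * c          ≤⟨ *C≤bsum n q t half ⟩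
    bsum n (q + t)             ≤⟨ bsum≤2^ n (q + t) (≤-trans (m≤n*m (q + t) 2) half) ⟩
    2 ^ n                      ∎
    where
    open ≤-Reasoning
    q = n / 3
    c = n C q
    rearrange : ∀ a c → a * (8 * c) ≡ 8 * a * c
    rearrange = solve-∀
    eq : ∀ q t n → 3 * (2 * (q + t)) + (2 * n + n) + 0 ≡ 3 * n + (2 * (3 * q) + 6 * t)
    eq = solve-∀
    half : 2 * (q + t) ≤ n
    half = *-cancelˡ-≤ 3 (linear 0 (+-mono-≤ (*-monoʳ-≤ 2 (3*[n/3]≤n n)) 6t≤n) (eq q t n))

-- Upper bound for arbitrary seatings

Σ<-update : ∀ n {f g : ℕ → ℕ} s c → s < n → g s ≡ f s + c → (∀ t → t ≢ s → g t ≡ f t) →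
            Σ< n g ≡ Σ< n f + c
Σ<-update (suc n) {f} {g} s c (s≤s s≤n) at off with s ≟ n
... | yes refl = begin
  Σ< (suc n) g            ≡⟨ Σ<-suc n g ⟩
  Σ< n g + g n            ≡⟨ cong₂ _+_ (Σ<-cong n λ t t<n → off t (<⇒≢ t<n)) at ⟩
  Σ< n f + (f n + c)      ≡⟨ +-assoc (Σ< n f) (f n) c ⟨
  Σ< n f + f n + c        ≡⟨ cong (_+ c) (Σ<-suc n f) ⟨
  Σ< (suc n) f + c        ∎
  where open ≡-Reasoning
... | no s≢n = begin
  Σ< (suc n) g            ≡⟨ Σ<-suc n g ⟩
  Σ< n g + g n            ≡⟨ cong₂ _+_ (Σ<-update n s c (≤∧≢⇒< s≤n s≢n) at off) (off n (s≢n ∘ sym)) ⟩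
  Σ< n f + c + f n        ≡⟨ rearrange (Σ< n f) c (f n) ⟩
  Σ< n f + f n + c        ≡⟨ cong (_+ c) (Σ<-suc n f) ⟨
  Σ< (suc n) f + c        ∎
  where
  open ≡-Reasoning
  rearrange : ∀ a b c → a + b + c ≡ a + c + b
  rearrange = solve-∀

left : ℕ → ℕ → ℕ
left n s = if s ≡ᵇ 0 then n ∸ 1 else s ∸ 1

left-injective : ∀ n {s t} → s < n → t < n → left n s ≡ left n t → s ≡ t
left-injective n {zero}  {zero}  _   _   eq = refl
left-injective (suc n) {zero} {suc t} _ t<n refl = contradiction t<n (<-irrefl refl)
left-injective (suc n) {suc s} {zero} s<n _ refl = contradiction s<n (<-irrefl refl)
left-injective n {suc s} {suc t} _   _   eq = cong suc eq

Σ<-left : ∀ n f → Σ< n (f ∘ left n) ≡ Σ< n f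
Σ<-left zero    f = refl
Σ<-left (suc n) f = trans (Σ<-cons n (f ∘ left (suc n))) (trans (+-comm (f n) (Σ< n f)) (sym (Σ<-suc n f)))

napkin : ℕ → Sign → ℕ → ℕ
napkin n prefR s = s
napkin n prefL s = left n s

-- `happy d` and `settled d` hold the napkin on side d, which they preferred,
-- respectively had to accept.
data Status : Set where
  vacant deprived : Status
  happy settled   : Sign → Status

isDeprived : Status → ℕ
isDeprived deprived = 1
isDeprived _        = 0

isHappy : Sign → Status → ℕ
isHappy prefR (happy prefR) = 1
isHappy prefL (happy prefL) = 1
isHappy _     _             = 0

holds : Sign → Status → ℕ
holds prefR (happy prefR)   = 1
holds prefL (happy prefL)   = 1
holds prefR (settled prefR) = 1
holds prefL (settled prefL) = 1
holds _     _               = 0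

module Seating (n : ℕ) where

  outcome : List ℕ → Sign → ℕ → Status
  outcome taken d s =
    if free taken (napkin n d s) then happy d
    else if free taken (napkin n (opposite d) s) then settled (opposite d)
    else deprived

  takenAfter : Status → ℕ → List ℕ → List ℕ
  takenAfter (happy d)   s taken = napkin n d s ∷ taken
  takenAfter (settled d) s taken = napkin n d s ∷ taken
  takenAfter _           s taken = taken

  napkinlessGo-step : ∀ taken d s rest → napkinlessGo n taken ((d , s) ∷ rest) ≡
    isDeprived (outcome taken d s) + napkinlessGo n (takenAfter (outcome taken d s) s taken) rest
  napkinlessGo-step taken prefR s rest with free taken s
  ... | true = refl
  ... | false with free taken (left n s)
  ...   | true  = refl
  ...   | false = refl
  napkinlessGo-step taken prefL s rest with free taken (left n s)
  ... | true = refl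
  ... | false with free taken s
  ...   | true  = refl
  ...   | false = refl

  -- Every taken napkin is held by a neighbour.  Someone holding the left napkin
  -- without having preferred it, or holding none, lost the right one to the right
  -- neighbour; likewise with left and right exchanged.
  record Consistent (st : ℕ → Status) (taken : List ℕ) : Set where
    field
      chainL : ∀ u → u < n → isDeprived (st (left n u)) + holds prefL (st (left n u)) ≤
                             holds prefL (st u) + isHappy prefL (st (left n u))
      chainR : ∀ u → u < n → isDeprived (st u) + holds prefR (st u) ≤
                             holds prefR (st (left n u)) + isHappy prefR (st u)
      holder : ∀ u → u < n → free taken (left n u) ≡ false →
               1 ≤ holds prefL (st u) + holds prefR (st (left n u))
  open Consistent

  count : (Status → ℕ) → (ℕ → Status) → ℕ
  count f st = Σ< n (f ∘ st)

  -- Summing `chainL` (or `chainR`) around the table cancels the `holds` terms.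
  deprived≤happy : ∀ {st taken} d → Consistent st taken → count isDeprived st ≤ count (isHappy d) st
  deprived≤happy {st} prefL c = +-cancelʳ-≤ H _ _ (begin
    D + H                                                   ≡⟨ Σ<-+ n _ _ ⟨
    Σ< n (λ u → isDeprived (st u) + holds prefL (st u))     ≡⟨ Σ<-left n _ ⟨
    Σ< n (λ u → isDeprived (st (left n u)) + holds prefL (st (left n u)))
                                                            ≤⟨ Σ<-mono n (chainL c) ⟩
    Σ< n (λ u → holds prefL (st u) + isHappy prefL (st (left n u)))
                                                            ≡⟨ Σ<-+ n _ _ ⟩
    H + Σ< n (λ u → isHappy prefL (st (left n u)))          ≡⟨ cong (H +_) (Σ<-left n _) ⟩
    H + A                                                   ≡⟨ +-comm H A ⟩
    A + H                                                   ∎)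
    where
    open ≤-Reasoning
    D = count isDeprived st
    H = count (holds prefL) st
    A = count (isHappy prefL) st
  deprived≤happy {st} prefR c = +-cancelʳ-≤ H _ _ (begin
    D + H                                                   ≡⟨ Σ<-+ n _ _ ⟨
    Σ< n (λ u → isDeprived (st u) + holds prefR (st u))     ≤⟨ Σ<-mono n (chainR c) ⟩
    Σ< n (λ u → holds prefR (st (left n u)) + isHappy prefR (st u))
                                                            ≡⟨ Σ<-+ n _ _ ⟩
    Σ< n (λ u → holds prefR (st (left n u))) + A            ≡⟨ cong (_+ A) (Σ<-left n _) ⟩
    H + A                                                   ≡⟨ +-comm H A ⟩
    A + H                                                   ∎)
    where
    open ≤-Reasoning
    D = count isDeprived st
    H = count (holds prefR) st
    A = count (isHappy prefR) st

  update : (ℕ → Status) → ℕ → Status → ℕ → Status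
  update st s o t with t ≟ s
  ... | yes _ = o
  ... | no  _ = st t

  update-at : ∀ st s o → update st s o s ≡ o
  update-at st s o with s ≟ s
  ... | yes _  = refl
  ... | no s≢s = contradiction refl s≢s

  update-off : ∀ st s o t → t ≢ s → update st s o t ≡ st t
  update-off st s o t t≢s with t ≟ s
  ... | yes t≡s = contradiction t≡s t≢s
  ... | no  _   = refl

  count-update : ∀ f st s o → f vacant ≡ 0 → s < n → st s ≡ vacant →
                 count f (update st s o) ≡ count f st + f o
  count-update f st s o f0 s<n vac = Σ<-update n s (f o) s<n
    (trans (cong f (update-at st s o)) (sym (cong (_+ f o) (trans (cong f vac) f0))))
    (λ t t≢s → cong f (update-off st s o t t≢s))

  holds-update : ∀ d st s o t → st s ≡ vacant → holds d (st t) ≤ holds d (update st s o t)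
  holds-update d st s o t vac with t ≟ s
  ... | no  _    = ≤-refl
  ... | yes refl rewrite vac with d
  ...   | prefR = z≤n
  ...   | prefL = z≤n

  module _ {st taken} (c : Consistent st taken) {s} (s<n : s < n) (vac : st s ≡ vacant) where

    private
      -- A napkin has only two neighbouring seats and one of them is the vacant seat `s`, so a
      -- napkin missing beside `s` is held by the neighbour on that side.
      lostL : free taken (left n s) ≡ false → 1 ≤ holds prefR (st (left n s))
      lostL p = subst (λ v → 1 ≤ holds prefL v + holds prefR (st (left n s))) vac (holder c s s<n p)

      lostR : ∀ u → u < n → left n u ≡ s → free taken s ≡ false → 1 ≤ holds prefL (st u)
      lostR u u<n refl p = subst (1 ≤_) (+-identityʳ _)
        (subst (λ v → 1 ≤ holds prefL (st u) + holds prefR v) vac (holder c u u<n p))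

      chainL-new : ∀ d u → u < n → left n u ≡ s → let o = outcome taken d s in
                   isDeprived o + holds prefL o ≤ holds prefL (st u) + isHappy prefL o
      chainL-new prefR u u<n eq with free taken s in p
      ... | true = z≤n
      ... | false with free taken (left n s)
      ...   | true  = ≤-trans (lostR u u<n eq p) (m≤m+n _ _)
      ...   | false = ≤-trans (lostR u u<n eq p) (m≤m+n _ _)
      chainL-new prefL u u<n eq with free taken (left n s)
      ... | true = m≤n+m 1 _
      ... | false with free taken s in p
      ...   | true  = z≤n
      ...   | false = ≤-trans (lostR u u<n eq p) (m≤m+n _ _)

      chainR-new : ∀ d → let o = outcome taken d s in
                   isDeprived o + holds prefR o ≤ holds prefR (st (left n s)) + isHappy prefR o
      chainR-new prefR with free taken s
      ... | true = m≤n+m 1 _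
      ... | false with free taken (left n s) in p
      ...   | true  = z≤n
      ...   | false = ≤-trans (lostL p) (m≤m+n _ _)
      chainR-new prefL with free taken (left n s) in p
      ... | true = z≤n
      ... | false with free taken s
      ...   | true  = ≤-trans (lostL p) (m≤m+n _ _)
      ...   | false = ≤-trans (lostL p) (m≤m+n _ _)

      free-∷ : ∀ x y → free (x ∷ taken) y ≡ false → x ≡ y ⊎ free taken y ≡ false
      free-∷ x y p with x ≡ᵇ y in eq
      ... | true  = inj₁ (≡ᵇ⇒≡ x y (subst T (sym eq) _))
      ... | false = inj₂ p

      holder-old : ∀ o u → u < n → free taken (left n u) ≡ false →
                   1 ≤ holds prefL (update st s o u) + holds prefR (update st s o (left n u))
      holder-old o u u<n p = ≤-trans (holder c u u<n p)
        (+-mono-≤ (holds-update prefL st s o u vac) (holds-update prefR st s o (left n u) vac))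

      holder-new : ∀ o → 1 ≤ isDeprived o + (holds prefL o + holds prefR o) →
                   ∀ u → u < n → free (takenAfter o s taken) (left n u) ≡ false →
                   1 ≤ holds prefL (update st s o u) + holds prefR (update st s o (left n u))
      holder-new vacant () u u<n p
      holder-new deprived _ u u<n p = holder-old deprived u u<n p
      holder-new o@(happy prefR) _ u u<n p with free-∷ s (left n u) p
      ... | inj₂ old = holder-old o u u<n old
      ... | inj₁ eq  = ≤-trans (≤-reflexive (sym (cong (holds prefR)
                         (trans (cong (update st s o) (sym eq)) (update-at st s o))))) (m≤n+m _ _)
      holder-new o@(settled prefR) _ u u<n p with free-∷ s (left n u) p
      ... | inj₂ old = holder-old o u u<n old
      ... | inj₁ eq  = ≤-trans (≤-reflexive (sym (cong (holds prefR)
                         (trans (cong (update st s o) (sym eq)) (update-at st s o))))) (m≤n+m _ _)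
      holder-new o@(happy prefL) _ u u<n p with free-∷ (left n s) (left n u) p
      ... | inj₂ old = holder-old o u u<n old
      ... | inj₁ eq  = ≤-trans (≤-reflexive (sym (cong (holds prefL)
                         (trans (cong (update st s o) (sym (left-injective n s<n u<n eq))) (update-at st s o)))))
                         (m≤m+n _ _)
      holder-new o@(settled prefL) _ u u<n p with free-∷ (left n s) (left n u) p
      ... | inj₂ old = holder-old o u u<n old
      ... | inj₁ eq  = ≤-trans (≤-reflexive (sym (cong (holds prefL)
                         (trans (cong (update st s o) (sym (left-injective n s<n u<n eq))) (update-at st s o)))))
                         (m≤m+n _ _)

      outcome-seated : ∀ d → let o = outcome taken d s in 1 ≤ isDeprived o + (holds prefL o + holds prefR o)
      outcome-seated d with free taken (napkin n d s)
      outcome-seated prefR | true = s≤s z≤n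
      outcome-seated prefL | true = s≤s z≤n
      outcome-seated d | false with free taken (napkin n (opposite d) s)
      outcome-seated prefR | false | true = s≤s z≤n
      outcome-seated prefL | false | true = s≤s z≤n
      outcome-seated d | false | false = s≤s z≤n

    consistent-step : ∀ d → let o = outcome taken d s in
                      Consistent (update st s o) (takenAfter o s taken)
    consistent-step d = record { chainL = newL ; chainR = newR ; holder = holder-new o (outcome-seated d) }
      where
      o = outcome taken d s
      newL : ∀ u → u < n → isDeprived (update st s o (left n u)) + holds prefL (update st s o (left n u)) ≤
                           holds prefL (update st s o u) + isHappy prefL (update st s o (left n u))
      -- The inequality whose left side concerns `s` is the new one. The one with `u` equal to `s`
      -- changes too, but only by a larger `holds` on the right, since a vacant seat holds nothing.
      newL u u<n with left n u ≟ s
      ... | yes eq = ≤-trans (chainL-new d u u<n eq) (+-monoˡ-≤ _ (holds-update prefL st s o u vac))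
      ... | no  _  = ≤-trans (chainL c u u<n) (+-monoˡ-≤ _ (holds-update prefL st s o u vac))
      newR : ∀ u → u < n → isDeprived (update st s o u) + holds prefR (update st s o u) ≤
                           holds prefR (update st s o (left n u)) + isHappy prefR (update st s o u)
      newR u u<n with u ≟ s
      ... | yes refl = ≤-trans (chainR-new d) (+-monoˡ-≤ _ (holds-update prefR st s o (left n s) vac))
      ... | no  _    = ≤-trans (chainR c u u<n) (+-monoˡ-≤ _ (holds-update prefR st s o (left n u) vac))

  Vacant : (ℕ → Status) → ℕ → Set
  Vacant st x = x < n × st x ≡ vacant

  vacant-step : ∀ {st s xs} o → All (s ≢_) xs → All (Vacant st) xs → All (Vacant (update st s o)) xs
  vacant-step o [] [] = []
  vacant-step {st} {s} {x ∷ _} o (s≢x ∷ ne) ((x<n , v) ∷ vs) =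
    (x<n , trans (update-off st s o x (s≢x ∘ sym)) v) ∷ vacant-step o ne vs

  isHappy-vacant : ∀ d → isHappy d vacant ≡ 0
  isHappy-vacant prefR = refl
  isHappy-vacant prefL = refl

  one-outcome : ∀ taken d s → let o = outcome taken d s in
                isDeprived o + (isHappy prefL o + isHappy prefR o) ≤ 1
  one-outcome taken d s with free taken (napkin n d s)
  one-outcome taken prefR s | true = s≤s z≤n
  one-outcome taken prefL s | true = s≤s z≤n
  one-outcome taken d s | false with free taken (napkin n (opposite d) s)
  one-outcome taken prefR s | false | true = z≤n
  one-outcome taken prefL s | false | true = z≤n
  one-outcome taken d s | false | false = s≤s z≤n

  deprived+happy≤1 : ∀ e taken d s → let o = outcome taken d s in isDeprived o + isHappy e o ≤ 1
  deprived+happy≤1 prefL taken d s =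
    ≤-trans (+-monoʳ-≤ (isDeprived (outcome taken d s)) (m≤m+n _ _)) (one-outcome taken d s)
  deprived+happy≤1 prefR taken d s =
    ≤-trans (+-monoʳ-≤ (isDeprived (outcome taken d s)) (m≤n+m _ _)) (one-outcome taken d s)

  happy-opposite : ∀ taken d s → isHappy (opposite d) (outcome taken d s) ≡ 0
  happy-opposite taken prefR s with free taken s
  ... | true = refl
  ... | false with free taken (left n s)
  ...   | true  = refl
  ...   | false = refl
  happy-opposite taken prefL s with free taken (left n s)
  ... | true = refl
  ... | false with free taken s
  ...   | true  = refl
  ...   | false = refl

  -- The three counted statuses are exclusive, so each diner to come adds at most 1 to their sum; at
  -- the end `deprived≤happy` makes either happy count at least the deprived one.
  bound₃ : ∀ {st taken} ss xs → Consistent st taken → All (Vacant st) xs → Unique xs → length ss ≡ length xs →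
           3 * (count isDeprived st + napkinlessGo n taken (zip ss xs)) ≤
           count isDeprived st + (count (isHappy prefL) st + count (isHappy prefR) st) + length ss
  bound₃ {st} [] [] c _ _ _ = linear 0 (+-mono-≤ (deprived≤happy prefL c) (deprived≤happy prefR c))
    (eq (count isDeprived st) (count (isHappy prefL) st) (count (isHappy prefR) st))
    where
    eq : ∀ k a b → 3 * (k + 0) + (a + b) + 0 ≡ k + (a + b) + 0 + (k + k)
    eq = solve-∀
  bound₃ {st} {taken} (d ∷ ss) (s ∷ xs) c ((s<n , vac) ∷ vs) (ne ∷ us) len
    with bound₃ ss xs (consistent-step c s<n vac d)
           (vacant-step (outcome taken d s) ne vs) us (suc-injective len)
  ... | ih rewrite napkinlessGo-step taken d s (zip ss xs)
                 | count-update isDeprived st s (outcome taken d s) refl s<n vac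
                 | count-update (isHappy prefL) st s (outcome taken d s) refl s<n vac
                 | count-update (isHappy prefR) st s (outcome taken d s) refl s<n vac =
    linear 0 (+-mono-≤ ih (one-outcome taken d s))
      (eq (count isDeprived st) (count (isHappy prefL) st) (count (isHappy prefR) st) (length ss)
          (isDeprived o) (isHappy prefL o) (isHappy prefR o) (napkinlessGo n (takenAfter o s taken) (zip ss xs)))
    where
    o = outcome taken d s
    eq : ∀ k a b l i x y g →
         3 * (k + (i + g)) + (k + i + (a + x + (b + y)) + l + 1) + 0 ≡
         k + (a + b) + suc l + (3 * (k + i + g) + (i + (x + y)))
    eq = solve-∀

  -- The potential of `bound₃` with a single preference. It takes over in `bound-hit` once the walk
  -- has reached its height.
  bound₂ : ∀ e {st taken} ss xs → Consistent st taken → All (Vacant st) xs → Unique xs → length ss ≡ length xs →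
           2 * (count isDeprived st + napkinlessGo n taken (zip ss xs)) ≤
           count isDeprived st + count (isHappy e) st + length ss
  bound₂ e {st} [] [] c _ _ _ = linear 0 (deprived≤happy e c)
    (eq (count isDeprived st) (count (isHappy e) st))
    where
    eq : ∀ k a → 2 * (k + 0) + a + 0 ≡ k + a + 0 + k
    eq = solve-∀
  bound₂ e {st} {taken} (d ∷ ss) (s ∷ xs) c ((s<n , vac) ∷ vs) (ne ∷ us) len
    with bound₂ e ss xs (consistent-step c s<n vac d)
           (vacant-step (outcome taken d s) ne vs) us (suc-injective len)
  ... | ih rewrite napkinlessGo-step taken d s (zip ss xs)
                 | count-update isDeprived st s (outcome taken d s) refl s<n vac
                 | count-update (isHappy e) st s (outcome taken d s) (isHappy-vacant e) s<n vac =
    linear 0 (+-mono-≤ ih (deprived+happy≤1 e taken d s))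
      (eq (count isDeprived st) (count (isHappy e) st) (length ss)
          (isDeprived o) (isHappy e o) (napkinlessGo n (takenAfter o s taken) (zip ss xs)))
    where
    o = outcome taken d s
    eq : ∀ k a l i x g →
         2 * (k + (i + g)) + (k + i + (a + x) + l + 1) + 0 ≡
         k + a + suc l + (2 * (k + i + g) + (i + x))
    eq = solve-∀

  -- Until the height is reached, a `d`-diner leaves `isHappy (opposite d)` unchanged. An opposite
  -- diner raises it by at most 1, worth 2 on the right; this pays for the step lost and for the
  -- diner used up. At the height, `bound₂` and `deprived≤happy` each contribute one copy of the
  -- count, whence the coefficient 2.
  bound-hit : ∀ d h {st taken} ss xs → Consistent st taken → All (Vacant st) xs → Unique xs →
              length ss ≡ length xs → hit d h ss ≡ true →
              2 * (count isDeprived st + napkinlessGo n taken (zip ss xs)) + h ≤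
              2 * count (isHappy (opposite d)) st + length ss
  bound-hit d zero {st} {taken} ss xs c vs us len _ =
    linear 0 (+-mono-≤ (bound₂ (opposite d) ss xs c vs us len) (deprived≤happy (opposite d) c))
      (eq (count isDeprived st) (count (isHappy (opposite d)) st) (length ss)
          (2 * (count isDeprived st + napkinlessGo n taken (zip ss xs))))
    where
    eq : ∀ k a l g → g + 0 + (k + a + l + a) + 0 ≡ 2 * a + l + (g + k)
    eq = solve-∀
  bound-hit d (suc h) {st} {taken} (t ∷ ss) (s ∷ xs) c ((s<n , vac) ∷ vs) (ne ∷ us) len p with relative d t
  ... | same
    with bound-hit d h ss xs (consistent-step c s<n vac d)
           (vacant-step (outcome taken d s) ne vs) us (suc-injective len) (trans (sym (hit-same d h ss)) p)
  ...   | ih rewrite napkinlessGo-step taken d s (zip ss xs)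
                 | count-update isDeprived st s (outcome taken d s) refl s<n vac
                 | count-update (isHappy (opposite d)) st s (outcome taken d s) (isHappy-vacant (opposite d)) s<n vac
                 | happy-opposite taken d s =
    linear 0 ih
      (eq (count isDeprived st) (count (isHappy (opposite d)) st) (length ss) h
          (isDeprived (outcome taken d s))
          (napkinlessGo n (takenAfter (outcome taken d s) s taken) (zip ss xs)))
    where
    eq : ∀ k a l h i g →
         2 * (k + (i + g)) + suc h + (2 * (a + 0) + l) + 0 ≡ 2 * a + suc l + (2 * (k + i + g) + h)
    eq = solve-∀
  bound-hit d (suc h) {st} {taken} (t ∷ ss) (s ∷ xs) c ((s<n , vac) ∷ vs) (ne ∷ us) len p | opp
    with bound-hit d (2 + h) ss xs (consistent-step c s<n vac t)
           (vacant-step (outcome taken t s) ne vs) us (suc-injective len) (trans (sym (hit-opposite d h ss)) p)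
  ... | ih rewrite napkinlessGo-step taken t s (zip ss xs)
                 | count-update isDeprived st s (outcome taken t s) refl s<n vac
                 | count-update (isHappy t) st s (outcome taken t s) (isHappy-vacant t) s<n vac =
    linear 0 (+-mono-≤ ih (*-monoʳ-≤ 2 (m+n≤o⇒n≤o (isDeprived o) (deprived+happy≤1 t taken t s))))
      (eq (count isDeprived st) (count (isHappy t) st) (length ss) h
          (isDeprived o) (isHappy t o) (napkinlessGo n (takenAfter o s taken) (zip ss xs)))
    where
    o = outcome taken t s
    eq : ∀ k a l h i x g →
         2 * (k + (i + g)) + suc h + (2 * (a + x) + l + 2 * 1) + 0 ≡
         2 * a + suc l + (2 * (k + i + g) + (2 + h) + 2 * x)
    eq = solve-∀

  private
    start : Consistent (λ _ → vacant) []
    start = record { chainL = λ _ _ → z≤n ; chainR = λ _ _ → z≤n ; holder = λ _ _ () }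

    count-start : ∀ f → f vacant ≡ 0 → count f (λ _ → vacant) ≡ 0
    count-start f f0 rewrite f0 = trans (Σ<-const n 0) (*-zeroʳ n)

  module _ {pos : Fin n → Fin n} (inj : Injective _≡_ _≡_ pos) (σ : Vec Sign n) where

    private
      xs = tabulate (λ j → toℕ (pos j))

      vacant-xs : All (Vacant (λ _ → vacant)) xs
      vacant-xs = All.tabulate⁺ (λ j → toℕ<n (pos j) , refl)

      unique-xs : Unique xs
      unique-xs = Unique.tabulate⁺ (λ eq → inj (toℕ-injective eq))

      len : length (toList σ) ≡ length xs
      len = trans (length-toList σ) (sym (length-tabulate _))

    3*napkinless≤n : 3 * napkinless n pos σ ≤ n
    3*napkinless≤n with bound₃ (toList σ) xs start vacant-xs unique-xs len
    ... | b rewrite count-start isDeprived refl | length-toList σ = b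

    2*napkinless+hit≤n : ∀ d h → hit d h (toList σ) ≡ true → 2 * napkinless n pos σ + h ≤ n
    2*napkinless+hit≤n d h p with bound-hit d h (toList σ) xs start vacant-xs unique-xs len p
    ... | b rewrite count-start isDeprived refl
                  | count-start (isHappy (opposite d)) (isHappy-vacant (opposite d)) | length-toList σ = b

-- Execution of Algorithm C

first-applyUpTo : ∀ (p : ℕ → Bool) f m x → x < m → (∀ i → i < x → p (f i) ≡ false) → p (f x) ≡ true →
                  first p (applyUpTo f m) ≡ just (f x)
first-applyUpTo p f (suc m) zero    _         below at rewrite at = refl
first-applyUpTo p f (suc m) (suc x) (s≤s x<m) below at rewrite below 0 (s≤s z≤n) =
  first-applyUpTo p (f ∘ suc) m x x<m (λ i i<x → below (suc i) (s≤s i<x)) at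

first-applyUpTo-none : ∀ (p : ℕ → Bool) f m → (∀ i → i < m → p (f i) ≡ false) →
                       first p (applyUpTo f m) ≡ nothing
first-applyUpTo-none p f zero    none = refl
first-applyUpTo-none p f (suc m) none rewrite none 0 (s≤s z≤n) =
  first-applyUpTo-none p (f ∘ suc) m (λ i i<m → none (suc i) (s≤s i<m))

first-filterᵇ : ∀ p xs → first (λ _ → true) (filterᵇ p xs) ≡ first p xs
first-filterᵇ p [] = refl
first-filterᵇ p (x ∷ xs) with p x
... | true  = refl
... | false = first-filterᵇ p xs

filterᵇ-head : ∀ (p : ℕ → Bool) (h f : ℕ → ℕ) ys m x → x < m →
               (∀ i → i < x → p (f i) ≡ false) → p (f x) ≡ true →
               first (λ _ → true) (map h (filterᵇ p (applyUpTo f m)) ++ ys) ≡ just (h (f x))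
filterᵇ-head p h f ys (suc m) zero    _         below at rewrite at = refl
filterᵇ-head p h f ys (suc m) (suc x) (s≤s x<m) below at rewrite below 0 (s≤s z≤n) =
  filterᵇ-head p h (f ∘ suc) ys m x x<m (λ i i<x → below (suc i) (s≤s i<x)) at

filterᵇ-none : ∀ (p : ℕ → Bool) (f : ℕ → ℕ) m → (∀ i → i < m → p (f i) ≡ false) →
               filterᵇ p (applyUpTo f m) ≡ []
filterᵇ-none p f zero    none = refl
filterᵇ-none p f (suc m) none rewrite none 0 (s≤s z≤n) =
  filterᵇ-none p (f ∘ suc) m (λ i i<m → none (suc i) (s≤s i<m))

≡ᵇ-refl : ∀ x → (x ≡ᵇ x) ≡ true
≡ᵇ-refl zero    = refl
≡ᵇ-refl (suc x) = ≡ᵇ-refl x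

≢⇒≡ᵇ-false : ∀ x y → x ≢ y → (x ≡ᵇ y) ≡ false
≢⇒≡ᵇ-false x y x≢y with x ≡ᵇ y in eq
... | true  = contradiction (≡ᵇ⇒≡ x y (subst T (sym eq) _)) x≢y
... | false = refl

free-snoc-self : ∀ used x → free (used ++ [ x ]) x ≡ false
free-snoc-self []         x rewrite ≡ᵇ-refl x = refl
free-snoc-self (y ∷ used) x with y ≡ᵇ x
... | true  = refl
... | false = free-snoc-self used x

free-snoc-used : ∀ used x y → free used y ≡ false → free (used ++ [ x ]) y ≡ false
free-snoc-used (z ∷ used) x y p with z ≡ᵇ y
... | true  = refl
... | false = free-snoc-used used x y p

free-snoc-free : ∀ used x y → free used y ≡ true → x ≢ y → free (used ++ [ x ]) y ≡ true
free-snoc-free []         x y p x≢y rewrite ≢⇒≡ᵇ-false x y x≢y = refl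
free-snoc-free (z ∷ used) x y p x≢y with z ≡ᵇ y
free-snoc-free (z ∷ used) x y () x≢y | true
... | false = free-snoc-free used x y p x≢y

free-∷-self : ∀ taken x → free (x ∷ taken) x ≡ false
free-∷-self taken x rewrite ≡ᵇ-refl x = refl

free-∷-used : ∀ taken x y → free taken y ≡ false → free (x ∷ taken) y ≡ false
free-∷-used taken x y p with x ≡ᵇ y
... | true  = refl
... | false = p

free-snoc⇒free : ∀ used x y → free (used ++ [ x ]) y ≡ true → free used y ≡ true
free-snoc⇒free used x y p with free used y in eq
... | true  = refl
... | false = contradiction (trans (sym p) (free-snoc-used used x y eq)) λ ()

-- `side prefR` is the leftmost seat of a bench, the trap-setting seat for diners who
-- prefer right, and `side prefL` the rightmost one; `spare` are the remainder seats.
data Kind : Set where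
  side         : Sign → Kind
  centre spare : Kind

side-injective : ∀ {d e} → side d ≡ side e → d ≡ e
side-injective refl = refl

_≟ᴷ_ : (κ λ′ : Kind) → Dec (κ ≡ λ′)
side d ≟ᴷ side e = map′ (cong side) side-injective (d Sign.≟ e)
side _ ≟ᴷ centre = no λ ()
side _ ≟ᴷ spare  = no λ ()
centre ≟ᴷ side _ = no λ ()
centre ≟ᴷ centre = yes refl
centre ≟ᴷ spare  = no λ ()
spare  ≟ᴷ side _ = no λ ()
spare  ≟ᴷ centre = no λ ()
spare  ≟ᴷ spare  = yes refl

encode : ℕ → Kind → ℕ → ℕ
encode q (side prefR) b = 3 * b
encode q (side prefL) b = 3 * b + 2
encode q centre       b = 3 * b + 1
encode q spare        i = 3 * q + i

nextBench : Kind × ℕ → Kind × ℕ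
nextBench (spare  , i) = spare , i
nextBench (side d , b) = side d , suc b
nextBench (centre , b) = centre , suc b

-- A left inverse of `encode`, recursing over benches. It makes the seats of all kinds distinct at
-- once, without comparing the kinds pairwise.
decode : ℕ → ℕ → Kind × ℕ
decode zero    i = spare , i
decode (suc q) 0 = side prefR , 0
decode (suc q) 1 = centre , 0
decode (suc q) 2 = side prefL , 0
decode (suc q) (suc (suc (suc x))) = nextBench (decode q x)

capacity : ℕ → ℕ → Kind → ℕ
capacity q r (side _) = q
capacity q r centre   = q
capacity q r spare    = r

decode-encode : ∀ q r κ b → b < capacity q r κ → decode q (encode q κ b) ≡ (κ , b)
decode-encode zero    r spare i _ = refl
decode-encode (suc q) r spare i i<r =
  trans (cong (λ x → decode (suc q) (x + i)) (*-suc 3 q)) (cong nextBench (decode-encode q r spare i i<r))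
decode-encode (suc q) r (side prefR) zero    _ = refl
decode-encode (suc q) r (side prefL) zero    _ = refl
decode-encode (suc q) r centre       zero    _ = refl
decode-encode (suc q) r (side prefR) (suc b) (s≤s b<q) =
  trans (cong (decode (suc q)) (*-suc 3 b)) (cong nextBench (decode-encode q r (side prefR) b b<q))
decode-encode (suc q) r (side prefL) (suc b) (s≤s b<q) =
  trans (cong (λ x → decode (suc q) (x + 2)) (*-suc 3 b)) (cong nextBench (decode-encode q r (side prefL) b b<q))
decode-encode (suc q) r centre       (suc b) (s≤s b<q) =
  trans (cong (λ x → decode (suc q) (x + 1)) (*-suc 3 b)) (cong nextBench (decode-encode q r centre b b<q))

encode< : ∀ q r κ b → b < capacity q r κ → encode q κ b < 3 * q + r
encode< q r spare        i i<r = +-monoʳ-< (3 * q) i<r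
encode< q r (side prefR) b b<q = linear (2 + r) (*-monoʳ-≤ 3 b<q) (eq b q r)
  where
  eq : ∀ b q r → suc (3 * b) + 3 * q + (2 + r) ≡ 3 * q + r + 3 * suc b
  eq = solve-∀
encode< q r (side prefL) b b<q = linear r (*-monoʳ-≤ 3 b<q) (eq b q r)
  where
  eq : ∀ b q r → suc (3 * b + 2) + 3 * q + r ≡ 3 * q + r + 3 * suc b
  eq = solve-∀
encode< q r centre       b b<q = linear (1 + r) (*-monoʳ-≤ 3 b<q) (eq b q r)
  where
  eq : ∀ b q r → suc (3 * b + 1) + 3 * q + (1 + r) ≡ 3 * q + r + 3 * suc b
  eq = solve-∀

-- How many seats of each kind are occupied; each kind is filled in increasing order.
Levels : Set
Levels = Kind → ℕ

bump : Kind → Levels → Levels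
bump κ st κ′ with κ′ ≟ᴷ κ
... | yes _ = suc (st κ′)
... | no  _ = st κ′

bump-at : ∀ κ st → bump κ st κ ≡ suc (st κ)
bump-at κ st with κ ≟ᴷ κ
... | yes _  = refl
... | no κ≢κ = contradiction refl κ≢κ

bump-off : ∀ κ st κ′ → κ′ ≢ κ → bump κ st κ′ ≡ st κ′
bump-off κ st κ′ κ′≢κ with κ′ ≟ᴷ κ
... | yes eq = contradiction eq κ′≢κ
... | no  _  = refl

bump-mono : ∀ κ st κ′ → st κ′ ≤ bump κ st κ′
bump-mono κ st κ′ with κ′ ≟ᴷ κ
... | yes _ = n≤1+n _
... | no  _ = ≤-refl

opposite-≢ : ∀ d → side (opposite d) ≢ side d
opposite-≢ prefR ()
opposite-≢ prefL ()

occupied : Levels → ℕ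
occupied st = st (side prefR) + st (side prefL) + st centre + st spare

occupied-bump : ∀ κ st → occupied (bump κ st) ≡ suc (occupied st)
occupied-bump (side prefR) st = refl
occupied-bump (side prefL) st = eq (st (side prefR)) (st (side prefL)) (st centre) (st spare)
  where
  eq : ∀ a b c e → a + suc b + c + e ≡ suc (a + b + c + e)
  eq = solve-∀
occupied-bump centre st = eq (st (side prefR)) (st (side prefL)) (st centre) (st spare)
  where
  eq : ∀ a b c e → a + b + suc c + e ≡ suc (a + b + c + e)
  eq = solve-∀
occupied-bump spare st = eq (st (side prefR)) (st (side prefL)) (st centre) (st spare)
  where
  eq : ∀ a b c e → a + b + c + suc e ≡ suc (a + b + c + e)
  eq = solve-∀

occupied-sides : ∀ d st → occupied st ≡ st (side d) + st (side (opposite d)) + st centre + st spare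
occupied-sides prefR st = refl
occupied-sides prefL st = cong (λ x → x + st centre + st spare) (+-comm (st (side prefR)) _)

module AlgorithmC (n : ℕ) where

  q r : ℕ
  q = n / 3
  r = n ∸ 3 * q

  n≡3q+r : n ≡ 3 * q + r
  n≡3q+r = sym (m+[n∸m]≡n (3*[n/3]≤n n))

  cap : Kind → ℕ
  cap = capacity q r

  seat : Kind → ℕ → ℕ
  seat = encode q

  seat-injective : ∀ {κ κ′ b b′} → b < cap κ → b′ < cap κ′ → seat κ b ≡ seat κ′ b′ → (κ , b) ≡ (κ′ , b′)
  seat-injective {κ} {κ′} {b} {b′} p p′ eq =
    trans (sym (decode-encode q r κ b p)) (trans (cong (decode q) eq) (decode-encode q r κ′ b′ p′))

  record Ready (st : Levels) (used : List ℕ) : Set where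
    field
      closed : ∀ κ b → b < st κ → free used (seat κ b) ≡ false
      open′  : ∀ κ b → st κ ≤ b → b < cap κ → free used (seat κ b) ≡ true
      capped : ∀ κ → st κ ≤ cap κ
      primed : ∀ d → st centre ≤ st (side d)

  ready-start : Ready (λ _ → 0) []
  ready-start = record
    { closed = λ _ _ () ; open′ = λ _ _ _ _ → refl ; capped = λ _ → z≤n ; primed = λ _ → z≤n }

  -- `own`, `spring` and `spoil` are branches (a), (b), (c); `waste` is (b) at a remainder seat.
  data Choice (st : Levels) (d : Sign) : Kind → Set where
    own    : st (side d) < q → Choice st d (side d)
    spring : st (side d) ≡ q → st centre < st (side (opposite d)) → Choice st d centre
    waste  : st (side d) ≡ q → st centre ≡ st (side (opposite d)) → st spare < r → Choice st d spare
    spoil  : st (side d) ≡ q → st centre ≡ st (side (opposite d)) → st spare ≡ r →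
             st (side (opposite d)) < q → Choice st d (side (opposite d))

  module _ {st used} (R : Ready st used) where
    open Ready R

    sideFree : Sign → Maybe ℕ
    sideFree prefR = leftmostFree n used
    sideFree prefL = rightmostFree n used

    sideFree-map : ∀ d → sideFree d ≡ first (free used) (applyUpTo (seat (side d)) q)
    sideFree-map prefR = cong (first (free used)) (map-upTo _ q)
    sideFree-map prefL = cong (first (free used)) (map-upTo _ q)

    sideFree-just : ∀ d → st (side d) < q → sideFree d ≡ just (seat (side d) (st (side d)))
    sideFree-just d l<q = trans (sideFree-map d)
      (first-applyUpTo (free used) (seat (side d)) q (st (side d)) l<q (closed (side d))
        (open′ (side d) _ ≤-refl l<q))

    sideFree-nothing : ∀ d → st (side d) ≡ q → sideFree d ≡ nothing
    sideFree-nothing d l≡q = trans (sideFree-map d)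
      (first-applyUpTo-none (free used) (seat (side d)) q
        (λ i i<q → closed (side d) i (subst (i <_) (sym l≡q) i<q)))

    isPrimed : ℕ → Bool
    isPrimed b = not (free used (3 * b)) ∧ not (free used (3 * b + 2)) ∧ free used (3 * b + 1)

    isPrimed-below : ∀ b → b < st centre → isPrimed b ≡ false
    isPrimed-below b b<c
      rewrite closed centre b b<c | ∧-zeroʳ (not (free used (3 * b + 2))) = ∧-zeroʳ (not (free used (3 * b)))

    isPrimed-above : ∀ d b → st (side d) ≤ b → b < q → isPrimed b ≡ false
    isPrimed-above prefR b l≤b b<q rewrite open′ (side prefR) b l≤b b<q = refl
    isPrimed-above prefL b l≤b b<q rewrite open′ (side prefL) b l≤b b<q = ∧-zeroʳ (not (free used (3 * b)))

    primedSeat-centre : (∀ d → st centre < st (side d)) → primedSeat n used ≡ just (seat centre (st centre))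
    primedSeat-centre c< = filterᵇ-head isPrimed (λ b → 3 * b + 1) (λ b → b) _ q (st centre) c<q isPrimed-below at
      where
      c<q : st centre < q
      c<q = ≤-trans (c< prefR) (capped (side prefR))
      at : isPrimed (st centre) ≡ true
      at rewrite closed (side prefR) _ (c< prefR) | closed (side prefL) _ (c< prefL)
               | open′ centre _ ≤-refl c<q = refl

    -- Benches below the centre level have their centre filled, and those from the level of `side d`
    -- on lack that side; when the levels agree, no bench remains.
    primedSeat-none : ∀ d → st centre ≡ st (side d) →
                      primedSeat n used ≡ first (free used) (applyUpTo (seat spare) r)
    primedSeat-none d c≡ = trans
      (cong (λ bs → first (λ _ → true) (map (λ b → 3 * b + 1) bs ++ filterᵇ (free used) (applyUpTo (seat spare) r)))
        (filterᵇ-none isPrimed (λ b → b) q none))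
      (first-filterᵇ (free used) (applyUpTo (seat spare) r))
      where
      none : ∀ b → b < q → isPrimed b ≡ false
      none b b<q with b <? st centre
      ... | yes b<c = isPrimed-below b b<c
      ... | no  b≮c = isPrimed-above d b (subst (_≤ b) c≡ (≮⇒≥ b≮c)) b<q

    seatC-sides : ∀ d → seatC n used d ≡ pick (sideFree d) (primedSeat n used) (sideFree (opposite d))
    seatC-sides prefR = refl
    seatC-sides prefL = refl

    seatC-choice : ∀ {d κ} → Choice st d κ → seatC n used d ≡ seat κ (st κ)
    seatC-choice {d} (own l<q) rewrite seatC-sides d | sideFree-just d l<q = refl
    seatC-choice {d} (spring l≡q c<)
      rewrite seatC-sides d | sideFree-nothing d l≡q
            | primedSeat-centre (both-signs (λ e → st centre < st (side e)) d
                (<-≤-trans c< (≤-trans (capped (side (opposite d))) (≤-reflexive (sym l≡q)))) c<) = refl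
    seatC-choice {d} (waste l≡q c≡ e<r)
      rewrite seatC-sides d | sideFree-nothing d l≡q | primedSeat-none (opposite d) c≡
            | first-applyUpTo (free used) (seat spare) r (st spare) e<r (closed spare)
                (open′ spare _ ≤-refl e<r) = refl
    seatC-choice {d} (spoil l≡q c≡ e≡r l′<q)
      rewrite seatC-sides d | sideFree-nothing d l≡q | primedSeat-none (opposite d) c≡
            | first-applyUpTo-none (free used) (seat spare) r
                (λ i i<r → closed spare i (subst (i <_) (sym e≡r) i<r))
            | sideFree-just (opposite d) l′<q = refl

    choose : ∀ d → occupied st < n → ∃ (Choice st d)
    choose d occ<n with st (side d) <? q
    ... | yes l<q = side d , own l<q
    ... | no  l≮q = full (≤-antisym (capped (side d)) (≮⇒≥ l≮q))
      where
      full : st (side d) ≡ q → ∃ (Choice st d)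
      full l≡q with st centre <? st (side (opposite d))
      ... | yes c< = centre , spring l≡q c<
      ... | no  c≮ with st spare <? r
      ...   | yes e<r = spare , waste l≡q (≤-antisym (primed (opposite d)) (≮⇒≥ c≮)) e<r
      -- Were the opposite side full as well, every kind would be at capacity and all `n` seats
      -- taken, with a diner still to be seated.
      ...   | no  e≮r = side (opposite d) , spoil l≡q c≡ e≡r
        (≤∧≢⇒< (capped (side (opposite d))) λ l′≡q → <-irrefl (begin
          occupied st
            ≡⟨ occupied-sides d st ⟩
          st (side d) + st (side (opposite d)) + st centre + st spare
            ≡⟨ cong₂ _+_ (cong₂ _+_ (cong₂ _+_ l≡q l′≡q) (trans c≡ l′≡q)) e≡r ⟩
          q + q + q + r
            ≡⟨ eq q r ⟩
          3 * q + r
            ≡⟨ n≡3q+r ⟨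
          n ∎) occ<n)
        where
        open ≡-Reasoning
        c≡ : st centre ≡ st (side (opposite d))
        c≡ = ≤-antisym (primed (opposite d)) (≮⇒≥ c≮)
        e≡r : st spare ≡ r
        e≡r = ≤-antisym (capped spare) (≮⇒≥ e≮r)
        eq : ∀ q r → q + q + q + r ≡ 3 * q + r
        eq = solve-∀

    choice< : ∀ {d κ} → Choice st d κ → st κ < cap κ
    choice< (own l<q)          = l<q
    choice< {d} (spring _ c<)  = <-≤-trans c< (capped (side (opposite d)))
    choice< (waste _ _ e<r)    = e<r
    choice< (spoil _ _ _ l<q)  = l<q

    choice-primed : ∀ {d} → Choice st d centre → ∀ e → st centre < st (side e)
    choice-primed {d} (spring l≡q c<) = both-signs (λ e → st centre < st (side e)) d
      (<-≤-trans c< (≤-trans (capped (side (opposite d))) (≤-reflexive (sym l≡q)))) c<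

    ready-step : ∀ {d κ} → Choice st d κ → Ready (bump κ st) (used ++ [ seatC n used d ])
    ready-step {d} {κ} ch rewrite seatC-choice ch = record
      { closed = closed′ ; open′ = open″ ; capped = capped′ ; primed = primed′ κ ch }
      where
      closed′ : ∀ κ′ b → b < bump κ st κ′ → free (used ++ [ seat κ (st κ) ]) (seat κ′ b) ≡ false
      closed′ κ′ b b< with κ′ ≟ᴷ κ
      ... | no  _ = free-snoc-used used _ _ (closed κ′ b b<)
      ... | yes refl with b ≟ st κ
      ...   | yes refl = free-snoc-self used _
      ...   | no  b≢   = free-snoc-used used _ _ (closed κ b (≤∧≢⇒< (s≤s⁻¹ b<) b≢))
      open″ : ∀ κ′ b → bump κ st κ′ ≤ b → b < cap κ′ → free (used ++ [ seat κ (st κ) ]) (seat κ′ b) ≡ true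
      open″ κ′ b l≤b b<cap = free-snoc-free used _ _
        (open′ κ′ b (≤-trans (bump-mono κ st κ′) l≤b) b<cap)
        λ eq → clash (seat-injective (choice< ch) b<cap eq)
        where
        clash : ¬ (κ , st κ) ≡ (κ′ , b)
        clash refl = 1+n≰n (subst (_≤ st κ) (bump-at κ st) l≤b)
      capped′ : ∀ κ′ → bump κ st κ′ ≤ cap κ′
      capped′ κ′ with κ′ ≟ᴷ κ
      ... | yes refl = choice< ch
      ... | no  _    = capped κ′
      primed′ : ∀ κ → Choice st d κ → ∀ e → bump κ st centre ≤ bump κ st (side e)
      primed′ centre   ch e = choice-primed ch e
      primed′ spare    ch e = primed e
      primed′ (side f) ch e = ≤-trans (primed e) (bump-mono (side f) st (side e))

  seats : List ℕ → List Sign → List ℕ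
  seats used []       = []
  seats used (d ∷ ss) = seatC n used d ∷ seats (used ++ [ seatC n used d ]) ss

  runCGo-seats : ∀ used ss → runCGo n used ss ≡ used ++ seats used ss
  runCGo-seats used []       = sym (++-identityʳ used)
  runCGo-seats used (d ∷ ss) = trans (runCGo-seats (used ++ [ seatC n used d ]) ss)
    (++-assoc used [ seatC n used d ] _)

  length-seats : ∀ used ss → length (seats used ss) ≡ length ss
  length-seats used []       = refl
  length-seats used (d ∷ ss) = cong suc (length-seats _ ss)

  occupied<n : ∀ st {l} → occupied st + suc l ≡ n → occupied st < n
  occupied<n st eq = ≤-trans (≤-trans (≤-reflexive (+-comm 1 _)) (+-monoʳ-≤ (occupied st) (s≤s z≤n)))
                                (≤-reflexive eq)

  occupied-step : ∀ κ st {l} → occupied st + suc l ≡ n → occupied (bump κ st) + l ≡ n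
  occupied-step κ st {l} eq = trans (cong (_+ l) (occupied-bump κ st)) (trans (sym (+-suc (occupied st) l)) eq)

  seats-valid : ∀ {st used} ss → Ready st used → occupied st + length ss ≡ n →
                All (λ x → x < n × free used x ≡ true) (seats used ss) × Unique (seats used ss)
  seats-valid [] R eq = [] , []
  seats-valid {st} {used} (d ∷ ss) R eq with choose R d (occupied<n st eq)
  ... | κ , ch with seats-valid ss (ready-step R ch) (occupied-step κ st eq)
  ...   | valid , unique =
    ((subst (_< n) (sym x≡) (subst (seat κ (st κ) <_) (sym n≡3q+r) (encode< q r κ (st κ) (choice< R ch))) ,
      trans (cong (free used) x≡) (Ready.open′ R κ _ ≤-refl (choice< R ch)))
     ∷ All.map (λ (y<n , fr) → y<n , free-snoc⇒free used x _ fr) valid)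
    , All.map (λ (_ , fr) x≡y → contradiction
        (trans (sym fr) (subst (λ y → free (used ++ [ x ]) y ≡ false) x≡y (free-snoc-self used x))) λ ()) valid
      ∷ unique
    where
    x = seatC n used d
    x≡ : x ≡ seat κ (st κ)
    x≡ = seatC-choice R ch

-- Lower bound for Algorithm C

clear : (ℕ → Bool) → ℕ → ℕ → Bool
clear good c b with b ≟ c
... | yes _ = false
... | no  _ = good b

clear-at : ∀ good c → clear good c c ≡ false
clear-at good c with c ≟ c
... | yes _  = refl
... | no c≢c = contradiction refl c≢c

clear-off : ∀ good c b → b ≢ c → clear good c b ≡ good b
clear-off good c b b≢c with b ≟ c
... | yes b≡c = contradiction b≡c b≢c
... | no  _   = refl

clear-⊆ : ∀ good c b → clear good c b ≡ true → good b ≡ true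
clear-⊆ good c b p with b ≟ c
... | no _ = p

-- `ρ` stands for the rotation of the table. It enters only through its compatibility with left
-- neighbours, stated for unreduced seat numbers, so the argument can stay in bench coordinates.
module LowerBound (n : ℕ) (ρ : ℕ → ℕ) (ρ-left : ∀ s → left n (ρ (suc s)) ≡ ρ s) where
  open AlgorithmC n
  open Seating n

  -- The napkin between the seat `side d` and the centre of bench `b`: the preferred one for a diner
  -- of preference `d` at that side.
  trapNapkin : Sign → ℕ → ℕ
  trapNapkin prefR b = 3 * b
  trapNapkin prefL b = 3 * b + 1

  side-napkin : ∀ d b → napkin n d (ρ (seat (side d) b)) ≡ ρ (trapNapkin d b)
  side-napkin prefR b = refl
  side-napkin prefL b = trans (cong (left n ∘ ρ) (+-suc (3 * b) 1)) (ρ-left _)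

  centre-napkin : ∀ d b → napkin n d (ρ (seat centre b)) ≡ ρ (trapNapkin (opposite d) b)
  centre-napkin prefR b = refl
  centre-napkin prefL b = trans (cong (left n ∘ ρ) (+-comm (3 * b) 1)) (ρ-left _)

  takenAfter-mono : ∀ o s taken y → free taken y ≡ false → free (takenAfter o s taken) y ≡ false
  takenAfter-mono vacant      s taken y p = p
  takenAfter-mono deprived    s taken y p = p
  takenAfter-mono (happy d)   s taken y p = free-∷-used taken (napkin n d s) y p
  takenAfter-mono (settled d) s taken y p = free-∷-used taken (napkin n d s) y p

  -- Either the diner takes the preferred napkin or it was gone already. A trap is therefore set in
  -- any case, and what happened on adjacent benches need not be known.
  takenAfter-preferred : ∀ taken d s →
                         free (takenAfter (outcome taken d s) s taken) (napkin n d s) ≡ false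
  takenAfter-preferred taken d s with free taken (napkin n d s) in p
  ... | true = free-∷-self taken (napkin n d s)
  ... | false with free taken (napkin n (opposite d) s)
  ...   | true  = free-∷-used taken (napkin n (opposite d) s) (napkin n d s) p
  ...   | false = p

  outcome-deprived : ∀ taken d s → free taken (napkin n d s) ≡ false →
                     free taken (napkin n (opposite d) s) ≡ false → outcome taken d s ≡ deprived
  outcome-deprived taken d s p p′ rewrite p | p′ = refl

  -- `good b`: the centre of bench b is empty and neither of its sides has been taken by
  -- a diner with the wrong preference.
  record Armed (st : Levels) (used taken : List ℕ) (good : ℕ → Bool) : Set where
    field
      ready : Ready st used
      armed : ∀ d b → b < st (side d) → good b ≡ true → free taken (ρ (trapNapkin d b)) ≡ false
      alive : ∀ b → good b ≡ true → st centre ≤ b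
  open Armed

  gain : (ℕ → Bool) → ℕ
  gain good = Σ< q (bit ∘ good)

  gain-clear : ∀ good c → c < q → gain good ≡ gain (clear good c) + bit (good c)
  gain-clear good c c<q = Σ<-update q c (bit (good c)) c<q
    (cong (λ x → bit x + bit (good c)) (sym (clear-at good c)))
    (λ t t≢c → cong bit (sym (clear-off good c t t≢c)))

  loss : ∀ {st d κ} → Choice st d κ → ℕ
  loss (spoil _ _ _ _) = 1
  loss _               = 0

  remaining : List ℕ → List ℕ → List Sign → ℕ
  remaining taken used ss = napkinlessGo n taken (zip ss (map ρ (seats used ss)))

  armed-step : ∀ {st used taken good} κ (good′ : ℕ → Bool) (taken′ : List ℕ) → Armed st used taken good →
    (∀ b → good′ b ≡ true → good b ≡ true) →
    (∀ y → free taken y ≡ false → free taken′ y ≡ false) →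
    (∀ e → κ ≡ side e → good′ (st (side e)) ≡ true → free taken′ (ρ (trapNapkin e (st (side e)))) ≡ false) →
    ∀ e b → b < bump κ st (side e) → good′ b ≡ true → free taken′ (ρ (trapNapkin e b)) ≡ false
  armed-step {st} κ good′ taken′ A sub mono new e b b< g with side e ≟ᴷ κ
  ... | no _ = mono _ (armed A e b b< (sub b g))
  ... | yes refl with b ≟ st (side e)
  ...   | yes refl = new e refl g
  ...   | no  b≢   = mono _ (armed A e b (≤∧≢⇒< (s≤s⁻¹ b<) b≢) (sub b g))

  -- One step, phrased as a transfer: a deficit `v` after it becomes a deficit `loss ch + v` before
  -- it. A bench leaves `good` only by `spring`, where its centre diner is deprived, or by `spoil`,
  -- where it counts as lost.
  advance : ∀ {st used taken good d κ} ss → Armed st used taken good → (ch : Choice st d κ) →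
    ∃₂ λ taken′ good′ → let used′ = used ++ [ seatC n used d ] in
      Armed (bump κ st) used′ taken′ good′ ×
      (∀ v → gain good′ ≤ remaining taken′ used′ ss + v →
             gain good ≤ remaining taken used (d ∷ ss) + (loss ch + v))
  advance {st} {used} {taken} {good} {d} ss A ch = go ch (seatC-choice (ready A) ch)
    where
    s = ρ (seatC n used d)
    o = outcome taken d s
    taken′ = takenAfter o s taken
    used′ = used ++ [ seatC n used d ]
    G′ = remaining taken′ used′ ss

    step : remaining taken used (d ∷ ss) ≡ isDeprived o + G′
    step = napkinlessGo-step taken d s (zip ss (map ρ (seats used′ ss)))

    mono : ∀ y → free taken y ≡ false → free taken′ y ≡ false
    mono = takenAfter-mono o s taken

    drop : ∀ v → gain good ≤ G′ + v → gain good ≤ remaining taken used (d ∷ ss) + v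
    drop v le = ≤-trans le (+-monoˡ-≤ v (subst (G′ ≤_) (sym step) (m≤n+m G′ (isDeprived o))))

    go : ∀ {κ} (ch : Choice st d κ) → seatC n used d ≡ seat κ (st κ) →
      ∃₂ λ taken′ good′ → Armed (bump κ st) used′ taken′ good′ ×
        (∀ v → gain good′ ≤ remaining taken′ used′ ss + v →
               gain good ≤ remaining taken used (d ∷ ss) + (loss ch + v))
    go ch@(own _) eq = taken′ , good , record
      { ready = ready-step (ready A) ch
      ; armed = armed-step (side d) good taken′ A (λ _ g → g) mono
          (λ { .d refl _ → subst (λ y → free taken′ y ≡ false)
                             (trans (cong (napkin n d ∘ ρ) eq) (side-napkin d _))
                             (takenAfter-preferred taken d s) })
      ; alive = alive A } , drop
    go ch@(waste _ _ _) eq = taken′ , good , record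
      { ready = ready-step (ready A) ch
      ; armed = armed-step spare good taken′ A (λ _ g → g) mono (λ _ ())
      ; alive = alive A } , drop
    go ch@(spoil _ _ _ l<q) eq = taken′ , clear good b , record
      { ready = ready-step (ready A) ch
      ; armed = armed-step (side (opposite d)) (clear good b) taken′ A (clear-⊆ good b) mono
          (λ { .(opposite d) refl g → contradiction (trans (sym g) (clear-at good b)) λ () })
      ; alive = λ b′ g → alive A b′ (clear-⊆ good b b′ g) }
      , λ v le → drop (suc v) (begin
          gain good                        ≡⟨ gain-clear good b l<q ⟩
          gain (clear good b) + bit (good b)  ≤⟨ +-mono-≤ le (bit≤1 (good b)) ⟩
          G′ + v + 1                       ≡⟨ rearrange G′ v ⟩
          G′ + suc v                       ∎)
      where
      open ≤-Reasoning
      b = st (side (opposite d))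
      rearrange : ∀ a v → a + v + 1 ≡ a + suc v
      rearrange = solve-∀
      bit≤1 : ∀ x → bit x ≤ 1
      bit≤1 true  = ≤-refl
      bit≤1 false = z≤n
    go ch@(spring _ _) eq = taken′ , clear good c , record
      { ready = ready-step (ready A) ch
      ; armed = armed-step centre (clear good c) taken′ A (clear-⊆ good c) mono (λ _ ())
      ; alive = λ b g → ≤∧≢⇒< (alive A b (clear-⊆ good c b g))
                          λ { refl → contradiction (trans (sym g) (clear-at good c)) λ () } }
      , λ v le → begin
          gain good                              ≡⟨ gain-clear good c (choice< (ready A) ch) ⟩
          gain (clear good c) + bit (good c)     ≤⟨ +-mono-≤ le trapped ⟩
          G′ + v + isDeprived o                  ≡⟨ rearrange G′ v (isDeprived o) ⟩
          isDeprived o + G′ + v                  ≡⟨ cong (_+ v) step ⟨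
          remaining taken used (d ∷ ss) + v      ∎
      where
      open ≤-Reasoning
      c = st centre
      rearrange : ∀ a v i → a + v + i ≡ i + a + v
      rearrange = solve-∀
      trapped : bit (good c) ≤ isDeprived o
      trapped with good c in g
      ... | false = z≤n
      ... | true  = ≤-reflexive (sym (cong isDeprived (outcome-deprived taken d s (lost d) (lost (opposite d)))))
        where
        lost : ∀ e → free taken (napkin n e s) ≡ false
        lost e = subst (λ y → free taken y ≡ false)
          (sym (trans (cong (napkin n e ∘ ρ) eq) (centre-napkin e c)))
          (armed A (opposite e) c (choice-primed (ready A) ch (opposite e)) g)

  -- At a full table the other kinds hold at most 2q + r diners, so all `q` centres are occupied and
  -- `alive` rules out any good bench.
  gain-end : ∀ {st used taken good} → Armed st used taken good → occupied st + 0 ≡ n → gain good ≡ 0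
  gain-end {st} {good = good} A eq = trans (Σ<-cong q dead) (trans (Σ<-const q 0) (*-zeroʳ q))
    where
    open Ready (ready A)
    cancel : ∀ q r c → q + (q + q + c + r) + 0 ≡ c + (3 * q + r)
    cancel = solve-∀
    q≤c : q ≤ st centre
    q≤c = linear 0 (≤-trans (≤-reflexive (trans (sym n≡3q+r) (trans (sym eq) (+-identityʳ _))))
      (+-mono-≤ (+-monoˡ-≤ (st centre) (+-mono-≤ (capped (side prefR)) (capped (side prefL)))) (capped spare)))
      (cancel q r (st centre))
    dead : ∀ b → b < q → bit (good b) ≡ 0
    dead b b<q with good b in g
    ... | false = refl
    ... | true  = contradiction (≤-trans q≤c (alive A b g)) (<⇒≱ b<q)

  -- Spoiling needs a side with room left, so nothing more can be lost from here on.
  both-full : ∀ {st used taken good} ss → Armed st used taken good → occupied st + length ss ≡ n →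
              (∀ d → st (side d) ≡ q) → gain good ≤ remaining taken used ss + 0
  both-full [] A occ full = ≤-reflexive (gain-end A occ)
  both-full {st} (d ∷ ss) A occ full with choose (ready A) d (occupied<n st occ)
  ... | κ , ch@(own l<q) = contradiction (full d) (<⇒≢ l<q)
  ... | κ , ch@(spoil _ _ _ l<q) = contradiction (full (opposite d)) (<⇒≢ l<q)
  ... | κ , ch@(spring _ _) with advance ss A ch
  ...   | _ , _ , A′ , back = back 0 (both-full ss A′ (occupied-step κ st occ) full)
  both-full {st} (d ∷ ss) A occ full | κ , ch@(waste _ _ _) with advance ss A ch
  ...   | _ , _ , A′ , back = back 0 (both-full ss A′ (occupied-step κ st occ) full)

  -- Losing 1 + v benches to diners of preference d means that the walk in direction d
  -- rises by exactly the h determined by the remaining empty seats.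
  one-full : ∀ d {st used taken good} ss → Armed st used taken good → occupied st + length ss ≡ n →
    st (side d) ≡ q →
    gain good ≤ remaining taken used ss + 0 ⊎
    ∃₂ λ v h → gain good ≤ remaining taken used ss + suc v ×
               h + (st spare + st centre) ≡ suc (r + st (side (opposite d)) + 2 * v) ×
               hit d h ss ≡ true
  one-full d [] A occ full = inj₁ (≤-reflexive (gain-end A occ))
  one-full d {st} (s ∷ ss) A occ full with st (side (opposite d)) ≟ q
  ... | yes full′ = inj₁ (both-full (s ∷ ss) A occ (both-signs (λ e → st (side e) ≡ q) d full full′))
  ... | no ¬full with relative d s
  one-full d {st} (.d ∷ ss) A occ full | no ¬full | same with choose (ready A) d (occupied<n st occ)
  ... | κ , own l<q = contradiction full (<⇒≢ l<q)
  ... | κ , ch@(spring _ _) with advance ss A ch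
  ...   | _ , _ , A′ , back with one-full d ss A′ (occupied-step κ st occ) full
  ...     | inj₁ le = inj₁ (back 0 le)
  ...     | inj₂ (v , h , le , eq , p) = inj₂ (v , suc h , back (suc v) le ,
              trans (rearrange h (st spare) (st centre)) eq , trans (hit-same d h ss) p)
    where
    rearrange : ∀ h e c → suc h + (e + c) ≡ h + (e + suc c)
    rearrange = solve-∀
  one-full d {st} (.d ∷ ss) A occ full | no ¬full | same | κ , ch@(waste _ _ _) with advance ss A ch
  ...   | _ , _ , A′ , back with one-full d ss A′ (occupied-step κ st occ) full
  ...     | inj₁ le = inj₁ (back 0 le)
  ...     | inj₂ (v , h , le , eq , p) = inj₂ (v , suc h , back (suc v) le ,
              trans (sym (+-suc h _)) eq , trans (hit-same d h ss) p)
  one-full d {st} (.d ∷ ss) A occ full | no ¬full | same | κ , ch@(spoil _ c≡ e≡ _) with advance ss A ch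
  ...   | _ , _ , A′ , back with one-full d ss A′ (occupied-step κ st occ)
                                   (trans (bump-off κ st (side d) (opposite-≢ d ∘ sym)) full)
  -- This is the last spoilt bench. Its branch has the remainder seats full and the centres level
  -- with the opposite side, so the present step is all that is still to climb.
  ...     | inj₁ le = inj₂ (0 , 1 , back 0 le ,
              cong suc (trans (cong₂ _+_ e≡ c≡) (sym (+-identityʳ _))) , hit-same d 0 ss)
  ...     | inj₂ (v , h , le , eq , p) = inj₂ (suc v , suc h , back (suc v) le ,
              cong suc (trans eq (trans (cong (λ x → suc (r + x + 2 * v)) (bump-at κ st))
                (rearrange r (st κ) v))) , trans (hit-same d h ss) p)
    where
    rearrange : ∀ r x v → suc (r + suc x + 2 * v) ≡ r + x + 2 * suc v
    rearrange = solve-∀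
  one-full d {st} (s ∷ ss) A occ full | no ¬full | opp with choose (ready A) s (occupied<n st occ)
  ... | κ , spring l≡q _ = contradiction l≡q ¬full
  ... | κ , waste l≡q _ _ = contradiction l≡q ¬full
  ... | κ , spoil l≡q _ _ _ = contradiction l≡q ¬full
  ... | κ , ch@(own _) with advance ss A ch
  ...   | _ , _ , A′ , back with one-full d ss A′ (occupied-step κ st occ)
                                   (trans (bump-off κ st (side d) (opposite-≢ d ∘ sym)) full)
  ...     | inj₁ le = inj₁ (back 0 le)
  ...     | inj₂ (v , h , le , eq , p) with high
    where
    eq′ : h + (st spare + st centre) ≡ suc (r + suc (st κ) + 2 * v)
    eq′ = trans eq (cong (λ x → suc (r + x + 2 * v)) (bump-at κ st))
    arith : ∀ r x v h m → 2 + (h + m) + (r + x) + 2 * v ≡ h + (suc (r + suc x + 2 * v) + m)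
    arith = solve-∀
    -- `hit-opposite` applies only to a height of the form 2 + h′. The equation provides it, because
    -- `st spare` is at most `r` and `st centre` at most the old level of the opposite side.
    high : ∃ λ h′ → h ≡ 2 + h′
    high = h ∸ 2 , sym (m+[n∸m]≡n (linear {a = 2} {b = h} (2 * v)
      (+-mono-≤ (≤-reflexive (sym eq′)) (+-mono-≤ (Ready.capped (ready A) spare) (Ready.primed (ready A) (opposite d))))
      (arith r (st κ) v h (st spare + st centre))))
  ...       | h′ , refl = inj₂ (v , suc h′ , back (suc v) le ,
              suc-injective (trans eq (trans (cong (λ x → suc (r + x + 2 * v)) (bump-at κ st))
                (rearrange r (st κ) v))) , trans (hit-opposite d h′ ss) p)
    where
    rearrange : ∀ r x v → suc (r + suc x + 2 * v) ≡ suc (suc (r + x + 2 * v))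
    rearrange = solve-∀

  -- For empty centres and remainder seats, `h` is what the walk gains up to the last of 1 + v
  -- losses. Diners of preference `d` still fill their own sides, `r` remainder seats, 1 + v wrong
  -- sides, and as many centres as the opposite side has seats filled before the last loss. The
  -- opposite diners to come cancel, since each of them adds one such centre.
  Lost : Levels → List ℕ → List ℕ → (ℕ → Bool) → List Sign → Sign → ℕ → ℕ → Set
  Lost st used taken good ss d v h =
    gain good ≤ remaining taken used ss + suc v ×
    h + st (side d) ≡ suc (q + r + st (side (opposite d)) + 2 * v) ×
    hit d h ss ≡ true

  one-full⇒lost : ∀ d {st used taken good} ss → Armed st used taken good → occupied st + length ss ≡ n →
    st centre ≡ 0 → st spare ≡ 0 → st (side d) ≡ q →
    gain good ≤ remaining taken used ss + 0 ⊎
    ∃ λ d → ∃₂ λ v h → Lost st used taken good ss d v h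
  one-full⇒lost d {st} ss A occ c0 e0 full with one-full d ss A occ full
  ... | inj₁ le = inj₁ le
  ... | inj₂ (v , h , le , eq , p) = inj₂ (d , v , h , le ,
    trans (cong₂ _+_ (trans (sym (trans (cong (h +_) (cong₂ _+_ e0 c0)) (+-identityʳ h))) eq) full)
          (rearrange q r (st (side (opposite d))) v) , p)
    where
    rearrange : ∀ q r x v → suc (r + x + 2 * v) + q ≡ suc (q + r + x + 2 * v)
    rearrange = solve-∀

  -- While neither side is full every diner takes a seat of their own side, and which preference
  -- will spoil benches is still open; hence the existential `d`.
  setting-traps : ∀ {st used taken good} ss → Armed st used taken good → occupied st + length ss ≡ n →
    st centre ≡ 0 → st spare ≡ 0 →
    gain good ≤ remaining taken used ss + 0 ⊎
    ∃ λ d → ∃₂ λ v h → Lost st used taken good ss d v h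
  setting-traps [] A occ c0 e0 = inj₁ (≤-reflexive (gain-end A occ))
  setting-traps {st} {used} {taken} {good} (s ∷ ss) A occ c0 e0 with st (side s) ≟ q | st (side (opposite s)) ≟ q
  ... | yes full | _        = one-full⇒lost s (s ∷ ss) A occ c0 e0 full
  ... | no _     | yes full = one-full⇒lost (opposite s) (s ∷ ss) A occ c0 e0 full
  ... | no ¬full | no ¬full′ with choose (ready A) s (occupied<n st occ)
  ...   | κ , spring l≡q _ = contradiction l≡q ¬full
  ...   | κ , waste l≡q _ _ = contradiction l≡q ¬full
  ...   | κ , spoil l≡q _ _ _ = contradiction l≡q ¬full
  ...   | κ , ch@(own _) with advance ss A ch
  ...     | _ , _ , A′ , back with setting-traps ss A′ (occupied-step κ st occ) c0 e0
  ...       | inj₁ le = inj₁ (back 0 le)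
  ...       | inj₂ (d , v , h , le , eq , p) with relative s d
  ...         | same = inj₂ (s , v , suc h , back (suc v) le ,
      trans (sym (+-suc h _)) (trans (cong (h +_) (sym (bump-at κ st)))
        (trans eq (cong (λ x → suc (q + r + x + 2 * v)) (bump-off κ st _ (opposite-≢ s))))) ,
      trans (hit-same s h ss) p)
  ...         | opp = descend h eq′ p
    where
    eq′ : h + st (side (opposite s)) ≡ suc (q + r + suc (st κ) + 2 * v)
    eq′ = trans (cong (h +_) (sym (bump-off κ st _ (opposite-≢ s))))
      (trans eq (cong (λ x → suc (q + r + x + 2 * v))
        (trans (cong (λ e → bump κ st (side e)) (Sign.opposite-involutive s)) (bump-at κ st))))
    rearrange : ∀ q r x v → suc (q + r + suc x + 2 * v) ≡ suc (suc (q + r + x + 2 * v))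
    rearrange = solve-∀
    arith : ∀ q r x v h m → 2 + (h + m + q) + (r + x + 2 * v) ≡ h + (suc (q + r + suc x + 2 * v) + m)
    arith = solve-∀
    -- Here the bound h ≥ 2 comes from `st (side (opposite s))` being at most `q`.
    descend : ∀ h → h + st (side (opposite s)) ≡ suc (q + r + suc (st κ) + 2 * v) →
              hit (opposite s) h ss ≡ true → _
    descend h eq p with h ∸ 2 | m+[n∸m]≡n {2} {h} (linear {a = 2} {b = h} (r + st κ + 2 * v)
      (+-mono-≤ (≤-reflexive (sym eq)) (Ready.capped (ready A) (side (opposite s))))
      (arith q r (st κ) v h (st (side (opposite s)))))
    ... | h′ | refl = inj₂ (opposite s , v , suc h′ , back (suc v) le ,
      suc-injective (trans eq (trans (rearrange q r (st κ) v)
        (cong (λ e → suc (suc (q + r + st (side e) + 2 * v))) (sym (Sign.opposite-involutive s))))) ,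
      trans (cong (λ e → hit (opposite s) (suc h′) (e ∷ ss)) (sym (Sign.opposite-involutive s)))
            (trans (hit-opposite (opposite s) h′ ss) p))

  gain-start : gain (λ _ → true) ≡ q
  gain-start = trans (Σ<-const q 1) (*-identityʳ q)

  algorithmC-lower : ∀ ss → length ss ≡ n → let ν = napkinlessGo n [] (zip ss (map ρ (seats [] ss))) in
    q ≤ ν ⊎ ∃ λ d → ∃ λ v → q ≤ ν + suc v × hit d (suc (q + r + 2 * v)) ss ≡ true
  algorithmC-lower ss len with setting-traps {λ _ → 0} {[]} {[]} {λ _ → true} ss start len refl refl
    where
    start : Armed (λ _ → 0) [] [] (λ _ → true)
    start = record { ready = ready-start ; armed = λ _ _ () ; alive = λ _ _ → z≤n }
  ... | inj₁ le = inj₁ (subst₂ _≤_ gain-start (+-identityʳ _) le)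
  ... | inj₂ (d , v , h , le , eq , p) = inj₂ (d , v ,
          subst (_≤ napkinlessGo n [] (zip ss (map ρ (seats [] ss))) + suc v) gain-start le ,
          subst (λ h → hit d h ss ≡ true)
            (trans (sym (+-identityʳ h)) (trans eq (cong (λ x → suc (x + 2 * v)) (+-identityʳ (q + r))))) p)

-- Counting preference orders

nth-All : ∀ {P : ℕ → Set} {xs} i → i < length xs → All P xs → P (nth xs i)
nth-All zero    _         (p ∷ _)  = p
nth-All (suc i) (s≤s i<l) (_ ∷ ps) = nth-All i i<l ps

nth-injective : ∀ {xs} i j → i < length xs → j < length xs → Unique xs → nth xs i ≡ nth xs j → i ≡ j
nth-injective zero    zero    _         _         _        _  = refl
nth-injective zero    (suc j) _         (s≤s j<l) (ne ∷ _) eq = contradiction eq (nth-All j j<l ne)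
nth-injective (suc i) zero    (s≤s i<l) _         (ne ∷ _) eq = contradiction (sym eq) (nth-All i i<l ne)
nth-injective (suc i) (suc j) (s≤s i<l) (s≤s j<l) (_ ∷ us) eq = cong suc (nth-injective i j i<l j<l us eq)

tabulate-nth : ∀ {n} (f : ℕ → ℕ) xs → length xs ≡ n → tabulate {n = n} (λ j → f (nth xs (toℕ j))) ≡ map f xs
tabulate-nth f []       refl = refl
tabulate-nth f (x ∷ xs) refl = cong (f x ∷_) (tabulate-nth f xs refl)

-- Pigeonhole: punching a missed value out of the codomain would leave an injection into a smaller
-- set.
injective⇒preimage : ∀ {n} {f : Fin n → Fin n} → Injective _≡_ _≡_ f → ∀ y → ∃ λ x → f x ≡ y
injective⇒preimage {suc n} {f} inj y with any? (λ x → f x Fin.≟ y)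
... | yes found = found
... | no  none  = contradiction
  (λ {i} {j} eq → inj (punchOut-injective (missed i) (missed j) eq)) (<⇒notInjective {f = λ x → punchOut (missed x)} ≤-refl)
  where
  missed : ∀ x → y ≢ f x
  missed x y≡fx = none (x , sym y≡fx)

left-% : ∀ m y → left (suc m) (suc y % suc m) ≡ y % suc m
left-% m y = trans (cong (left (suc m)) reduce) (wrap (y % suc m) (m%n<n y (suc m)))
  where
  reduce : suc y % suc m ≡ suc (y % suc m) % suc m
  reduce = trans (cong (λ z → suc z % suc m) (m≡m%n+[m/n]*n y (suc m)))
                 ([m+kn]%n≡m%n (suc (y % suc m)) (y / suc m) (suc m))
  wrap : ∀ z → z < suc m → left (suc m) (suc z % suc m) ≡ z
  wrap z z<n with suc z <? suc m
  ... | yes sz<n = cong (left (suc m)) (m<n⇒m%n≡m sz<n)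
  ... | no  sz≮n with ≤-antisym z<n (≮⇒≥ sz≮n)
  ...   | refl = cong (left (suc m)) (n%n≡0 (suc m))

bit-≡ᵇ-<ᵇ : ∀ x k → bit (x ≡ᵇ k) + bit (x <ᵇ k) ≡ bit (x <ᵇ suc k)
bit-≡ᵇ-<ᵇ zero    zero    = refl
bit-≡ᵇ-<ᵇ zero    (suc k) = refl
bit-≡ᵇ-<ᵇ (suc x) zero    = refl
bit-≡ᵇ-<ᵇ (suc x) (suc k) = bit-≡ᵇ-<ᵇ x k

<⇒bit : ∀ {x k} → x < k → bit (x <ᵇ k) ≡ 1
<⇒bit (s≤s {zero}  _)   = refl
<⇒bit (s≤s {suc x} x<k) = <⇒bit x<k

≮⇒bit : ∀ {x k} → ¬ x < k → bit (x <ᵇ k) ≡ 0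
≮⇒bit {x} {k} x≮k with x <ᵇ k in eq
... | true  = contradiction (<ᵇ⇒< x k (subst T (sym eq) _)) x≮k
... | false = refl

-- The indices k < q with x ≤ k number q - x. Summed over all preference orders, this expresses the
-- shortfall from `q` through the cumulative counts of `count<`.
layer-cake : ∀ x q → x ≤ q → x + Σ< q (λ k → bit (x <ᵇ suc k)) ≡ q
layer-cake zero    q       _         = trans (Σ<-const q 1) (*-identityʳ q)
layer-cake (suc x) (suc q) (s≤s x≤q) = cong suc (trans
  (cong (x +_) (Σ<-cons q (λ k → bit (suc x <ᵇ suc k)))) (layer-cake x q x≤q))

Σ<-* : ∀ c q f → Σ< q (λ k → c * f k) ≡ c * Σ< q f
Σ<-* c zero    f = sym (*-zeroʳ c)
Σ<-* c (suc q) f = trans (Σ<-suc q _) (trans (cong (_+ c * f q) (Σ<-* c q f))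
  (trans (sym (*-distribˡ-+ c (Σ< q f) (f q))) (cong (c *_) (sym (Σ<-suc q f)))))

-- Optimality, distribution and expectation of Algorithm C

module Clairvoyant (m : ℕ) where

  n : ℕ
  n = suc m

  open AlgorithmC n
  open Seating n using (3*napkinless≤n; 2*napkinless+hit≤n)

  module _ (σ : Vec Sign n) where

    private
      ss = toList σ
      xs = seats [] ss
      x₀ = nth (runC n σ) 0

      run≡ : runC n σ ≡ xs
      run≡ = runCGo-seats [] ss

      length-xs : length xs ≡ n
      length-xs = trans (length-seats [] ss) (length-toList σ)

      valid : All (λ x → x < n × free [] x ≡ true) xs × Unique xs
      valid = seats-valid ss ready-start (length-toList σ)

      nth< : ∀ (j : Fin n) → nth xs (toℕ j) < n
      nth< j = proj₁ (nth-All (toℕ j) (subst (toℕ j <_) (sym length-xs) (toℕ<n j)) (proj₁ valid))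

      x₀≤n : x₀ ≤ n
      x₀≤n = <⇒≤ (subst (λ ys → nth ys 0 < n) (sym run≡) (nth< 0F))

      ρ : ℕ → ℕ
      ρ x = (x + n ∸ x₀) % n

      ρ-left : ∀ s → left n (ρ (suc s)) ≡ ρ s
      -- The successor passes through the truncated subtraction because `x₀` is at most `n`.
      ρ-left s = trans (cong (λ y → left n (y % n)) (+-∸-assoc 1 (≤-trans x₀≤n (m≤n+m n s)))) (left-% m _)

      ρ-inverse : ∀ x → x < n → (ρ x + x₀) % n ≡ x
      ρ-inverse x x<n = begin
        (ρ x + x₀) % n                  ≡⟨ %-distribˡ-+ (ρ x) x₀ n ⟩
        (ρ x % n + x₀ % n) % n          ≡⟨ cong (λ y → (y + x₀ % n) % n) (m%n%n≡m%n (x + n ∸ x₀) n) ⟩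
        (ρ x + x₀ % n) % n              ≡⟨ %-distribˡ-+ (x + n ∸ x₀) x₀ n ⟨
        (x + n ∸ x₀ + x₀) % n           ≡⟨ cong (_% n) (m∸n+n≡m (≤-trans x₀≤n (m≤n+m n x))) ⟩
        (x + n) % n                     ≡⟨ [m+n]%n≡m%n x n ⟩
        x % n                           ≡⟨ m<n⇒m%n≡m x<n ⟩
        x                               ∎
        where open ≡-Reasoning

      toℕ-seatingC : ∀ j → toℕ (seatingC n σ j) ≡ ρ (nth xs (toℕ j))
      toℕ-seatingC j = trans (toℕ-fromℕ< _) (cong (λ ys → ρ (nth ys (toℕ j))) run≡)

    seatingC-injective : Injective _≡_ _≡_ (seatingC n σ)
    seatingC-injective {i} {j} eq = toℕ-injective
      (nth-injective (toℕ i) (toℕ j) (subst (toℕ i <_) (sym length-xs) (toℕ<n i))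
        (subst (toℕ j <_) (sym length-xs) (toℕ<n j)) (proj₂ valid) (begin
          nth xs (toℕ i)                      ≡⟨ ρ-inverse _ (nth< i) ⟨
          (ρ (nth xs (toℕ i)) + x₀) % n       ≡⟨ cong (λ y → (y + x₀) % n) same-ρ ⟩
          (ρ (nth xs (toℕ j)) + x₀) % n       ≡⟨ ρ-inverse _ (nth< j) ⟩
          nth xs (toℕ j)                      ∎))
      where
      open ≡-Reasoning
      same-ρ : ρ (nth xs (toℕ i)) ≡ ρ (nth xs (toℕ j))
      same-ρ = trans (sym (toℕ-seatingC i)) (trans (cong toℕ eq) (toℕ-seatingC j))

    seatingC-zero : toℕ (seatingC n σ 0F) ≡ 0
    seatingC-zero = begin
      toℕ (seatingC n σ 0F)   ≡⟨ toℕ-fromℕ< _ ⟩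
      (x₀ + n ∸ x₀) % n         ≡⟨ cong (_% n) (m+n∸m≡n x₀ n) ⟩
      n % n                     ≡⟨ n%n≡0 n ⟩
      0                         ∎
      where open ≡-Reasoning

    νC-lower : q ≤ νC n σ ⊎ ∃ λ d → ∃ λ v → q ≤ νC n σ + suc v × hit d (suc (q + r + 2 * v)) ss ≡ true
    νC-lower = subst (λ ν → q ≤ ν ⊎ ∃ λ d → ∃ λ v → q ≤ ν + suc v × hit d (suc (q + r + 2 * v)) ss ≡ true)
      (cong (λ ys → napkinlessGo n [] (zip ss ys))
        (sym (trans (tabulate-cong toℕ-seatingC) (tabulate-nth ρ xs length-xs))))
      (LowerBound.algorithmC-lower n ρ ρ-left ss (length-toList σ))

    napkinless≤q : ∀ {pos} → Injective _≡_ _≡_ pos → napkinless n pos σ ≤ q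
    napkinless≤q {pos} inj = s≤s⁻¹ (*-cancelˡ-< 3 (napkinless n pos σ) (suc q) (begin-strict
      3 * napkinless n pos σ   ≤⟨ 3*napkinless≤n inj σ ⟩
      n                        ≡⟨ m≡m%n+[m/n]*n n 3 ⟩
      n % 3 + q * 3            <⟨ +-monoˡ-< (q * 3) (m%n<n n 3) ⟩
      suc q * 3                ≡⟨ *-comm (suc q) 3 ⟩
      3 * suc q                ∎))
      where open ≤-Reasoning

    νC≤q : νC n σ ≤ q
    νC≤q = napkinless≤q seatingC-injective

    νC-optimal : ∀ {pos} → Injective _≡_ _≡_ pos → napkinless n pos σ ≤ νC n σ
    νC-optimal {pos} inj with νC-lower
    ... | inj₁ q≤νC = ≤-trans (napkinless≤q inj) q≤νC
    ... | inj₂ (d , v , q≤ , p) = s≤s⁻¹ (*-cancelˡ-< 2 (napkinless n pos σ) (suc (νC n σ))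
      (linear 0 (+-mono-≤ (subst (2 * napkinless n pos σ + suc (q + r + 2 * v) ≤_) n≡3q+r
                            (2*napkinless+hit≤n inj σ d _ p)) (*-monoʳ-≤ 2 q≤))
        (eq (napkinless n pos σ) (νC n σ) q r v)))
      where
      eq : ∀ a c q r v → suc (2 * a) + (3 * q + r + 2 * (c + suc v)) + 0 ≡
                         2 * suc c + (2 * a + suc (q + r + 2 * v) + 2 * q)
      eq = solve-∀

    hit⇒νC< : ∀ k h → 2 * k + h ≡ suc n → ∀ d → hit d h ss ≡ true → νC n σ < k
    hit⇒νC< k h eq d p = *-cancelˡ-< 2 (νC n σ) k (linear 0 (+-mono-≤ (≤-reflexive (sym eq))
      (2*napkinless+hit≤n seatingC-injective σ d h p)) (arith (νC n σ) k h n))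
      where
      arith : ∀ a k h n → suc (2 * a) + (2 * k + h + n) + 0 ≡ 2 * k + (suc n + (2 * a + h))
      arith = solve-∀

    νC<-hit : ∀ k h → k ≤ q → 2 * k + h ≡ suc n →
              bit (νC n σ <ᵇ k) ≡ bit (hit prefR h ss) + bit (hit prefL h ss)
    νC<-hit k h k≤q eq with hit prefR h ss in pR | hit prefL h ss in pL
    -- Since 6k ≤ 6q ≤ 2n, the height satisfies 3h = 3(n + 1) - 6k ≥ n + 3.
    ... | true | true = contradiction (≤-trans (≤-reflexive (eq₂ h)) 3h≤n) (<⇒≱ n<3h)
      where
      eq₂ : ∀ h → 3 * h ≡ h + 2 * h
      eq₂ = solve-∀
      3h≤n : h + 2 * h ≤ n
      3h≤n with hit-both h h ss pR pL
      ... | inj₁ le = ≤-trans (≤-reflexive (+-comm h (2 * h))) (subst (2 * h + h ≤_) (length-toList σ) le)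
      ... | inj₂ le = subst (h + 2 * h ≤_) (length-toList σ) le
      arith : ∀ k h n q → suc n + (6 * q + 3 * (2 * k + h) + 2 * n) + 2 ≡
                          3 * h + (6 * k + 3 * suc n + 2 * (3 * q))
      arith = solve-∀
      n<3h : n < 3 * h
      n<3h = linear 2 (+-mono-≤ (+-mono-≤ (*-monoʳ-≤ 6 k≤q) (*-monoʳ-≤ 3 (≤-reflexive (sym eq))))
                        (*-monoʳ-≤ 2 (3*[n/3]≤n n))) (arith k h n q)
    ... | true  | false = <⇒bit (hit⇒νC< k h eq prefR pR)
    ... | false | true  = <⇒bit (hit⇒νC< k h eq prefL pL)
    ... | false | false = ≮⇒bit not-below
      where
      missed : ∀ d → hit d h ss ≡ false
      missed prefR = pR
      missed prefL = pL
      not-below : ¬ νC n σ < k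
      not-below ν<k with νC-lower
      ... | inj₁ q≤ = contradiction (≤-trans k≤q q≤) (<⇒≱ ν<k)
      -- From q ≤ ν + 1 + v and ν < k follows q ≤ k + v, so the height q + r + 2v + 1 reached is at
      -- least h = 3q + r + 1 - 2k, and `hit-mono` applies.
      ... | inj₂ (d , v , q≤ , p) = contradiction
        (trans (sym (hit-mono d {h} ss (linear 0 (+-mono-≤ (*-monoʳ-≤ 2 (+-mono-≤ q≤ ν<k))
           (≤-reflexive (trans eq (cong suc n≡3q+r)))) (arith (νC n σ) k h q r v)) p)) (missed d)) λ ()
        where
        arith : ∀ a k h q r v → h + (2 * (a + suc v + k) + suc (3 * q + r)) + 0 ≡
                                suc (q + r + 2 * v) + (2 * (q + suc a) + (2 * k + h))
        arith = solve-∀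

    seatingOrderC : SeatingOrder n
    seatingOrderC = permutation (proj₁ ∘ inverse) (seatingC n σ)
      (λ j → seatingC-injective (proj₂ (inverse (seatingC n σ j)))) (proj₂ ∘ inverse) , first-seat
      where
      inverse : ∀ y → ∃ λ x → seatingC n σ x ≡ y
      inverse = injective⇒preimage seatingC-injective
      first-seat : ∀ i → toℕ i ≡ 0 → toℕ (proj₁ (inverse i)) ≡ 0
      first-seat i i≡0 = cong toℕ (seatingC-injective {proj₁ (inverse i)} {0F}
        (trans (proj₂ (inverse i)) (toℕ-injective (trans i≡0 (sym seatingC-zero)))))

  prefs = allPrefs n

  count< : ∀ k → k ≤ q → total (λ σ → bit (νC n σ <ᵇ k)) prefs ≡ 4 * bsum n k
  count< k k≤q = begin
    total (λ σ → bit (νC n σ <ᵇ k)) prefs     ≡⟨ total-cong (λ σ → νC<-hit σ k h k≤q eq) prefs ⟩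
    total (λ σ → bit (hit prefR h (toList σ)) + bit (hit prefL h (toList σ))) prefs
                                              ≡⟨ total-+ _ _ prefs ⟩
    hitCount prefR n h + hitCount prefL n h   ≡⟨ cong₂ _+_ (hitCount-bsum prefR n h k eq)
                                                           (hitCount-bsum prefL n h k eq) ⟩
    2 * bsum n k + 2 * bsum n k               ≡⟨ *-distribʳ-+ (bsum n k) 2 2 ⟨
    4 * bsum n k                              ∎
    where
    open ≡-Reasoning
    h = suc n ∸ 2 * k
    eq : 2 * k + h ≡ suc n
    eq = m+[n∸m]≡n (≤-trans (*-mono-≤ (n≤1+n 2) k≤q) (≤-trans (3*[n/3]≤n n) (n≤1+n n)))

  countC-step : ∀ k → countC n k + total (λ σ → bit (νC n σ <ᵇ k)) prefs ≡
                      total (λ σ → bit (νC n σ <ᵇ suc k)) prefs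
  countC-step k = begin
    countC n k + total (λ σ → bit (νC n σ <ᵇ k)) prefs
      ≡⟨ cong (_+ total (λ σ → bit (νC n σ <ᵇ k)) prefs) (length-filterᵇ _ prefs) ⟩
    total (λ σ → bit (νC n σ ≡ᵇ k)) prefs + total (λ σ → bit (νC n σ <ᵇ k)) prefs
      ≡⟨ total-+ _ _ prefs ⟨
    total (λ σ → bit (νC n σ ≡ᵇ k) + bit (νC n σ <ᵇ k)) prefs
      ≡⟨ total-cong (λ σ → bit-≡ᵇ-<ᵇ (νC n σ) k) prefs ⟩
    total (λ σ → bit (νC n σ <ᵇ suc k)) prefs ∎
    where open ≡-Reasoning

  count-all : ∀ k → q < k → total (λ σ → bit (νC n σ <ᵇ k)) prefs ≡ 2 ^ n
  count-all k q<k = trans (total-cong (λ σ → <⇒bit (≤-<-trans (νC≤q σ) q<k)) prefs)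
    (trans (total-const 1 prefs) (trans (*-identityˡ _) (length-allPrefs n)))

  countC-below : ∀ k → k < q → countC n k ≡ 4 * (n C k)
  countC-below k k<q = +-cancelʳ-≡ (4 * bsum n k) _ _ (begin
    countC n k + 4 * bsum n k                        ≡⟨ cong (countC n k +_) (count< k (<⇒≤ k<q)) ⟨
    countC n k + total (λ σ → bit (νC n σ <ᵇ k)) prefs ≡⟨ countC-step k ⟩
    total (λ σ → bit (νC n σ <ᵇ suc k)) prefs        ≡⟨ count< (suc k) k<q ⟩
    4 * bsum n (suc k)                               ≡⟨ cong (4 *_) (bsum-suc n k) ⟩
    4 * (bsum n k + n C k)                           ≡⟨ *-distribˡ-+ 4 (bsum n k) (n C k) ⟩
    4 * bsum n k + 4 * (n C k)                       ≡⟨ +-comm (4 * bsum n k) _ ⟩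
    4 * (n C k) + 4 * bsum n k                       ∎)
    where open ≡-Reasoning

  countC-top : countC n q + 4 * bsum n q ≡ 2 ^ n
  countC-top = trans (cong (countC n q +_) (sym (count< q ≤-refl))) (trans (countC-step q) (count-all (suc q) ≤-refl))

  countC-above : ∀ k → q < k → countC n k ≡ 0
  countC-above k q<k = +-cancelʳ-≡ (2 ^ n) _ 0 (trans (cong (countC n k +_) (sym (count-all k q<k)))
    (trans (countC-step k) (count-all (suc k) (m<n⇒m<1+n q<k))))

  totalC-defect : totalC n + defect n ≡ q * 2 ^ n
  totalC-defect = begin
    totalC n + defect n
      ≡⟨ cong (totalC n +_) (trans (defect-bsum n) (sym (Σ<-* 4 q _))) ⟩
    totalC n + Σ< q (λ k → 4 * bsum n (suc k))
      ≡⟨ cong (totalC n +_) (Σ<-cong q λ k k<q → count< (suc k) k<q) ⟨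
    totalC n + Σ< q (λ k → total (λ σ → bit (νC n σ <ᵇ suc k)) prefs)
      ≡⟨ cong (totalC n +_) (total-Σ< q (λ k σ → bit (νC n σ <ᵇ suc k)) prefs) ⟨
    totalC n + total (λ σ → Σ< q (λ k → bit (νC n σ <ᵇ suc k))) prefs
      ≡⟨ total-+ (νC n) _ prefs ⟨
    total (λ σ → νC n σ + Σ< q (λ k → bit (νC n σ <ᵇ suc k))) prefs
      ≡⟨ total-cong (λ σ → layer-cake (νC n σ) q (νC≤q σ)) prefs ⟩
    total (λ _ → q) prefs
      ≡⟨ total-const q prefs ⟩
    q * length prefs
      ≡⟨ cong (q *_) (length-allPrefs n) ⟩
    q * 2 ^ n ∎
    where open ≡-Reasoning

theorem1p1 : ((n : ℕ) → 3 ≤ n →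
    ((∀ k → k < n / 3 → countC n k ≡ 4 * (n C k))
    × (countC n (n / 3) + 4 * Σ< (n / 3) (λ i → n C i) ≡ 2 ^ n)
    × (∀ k → n / 3 < k → countC n k ≡ 0))
    × (totalC n + defect n ≡ (n / 3) * 2 ^ n)
    × ((σ : Vec Sign n) → Σ (SeatingOrder n) (λ w →
    (∀ (j : Fin n) → seatingOrderPos n w j ≡ seatingC n σ j)
    × (∀ (w′ : SeatingOrder n) → ν n w′ σ ≤ ν n w σ))))
    × ((m : ℕ) → ∃ λ N → (n : ℕ) → N ≤ n → suc m * defect n < 2 ^ n)
theorem1p1 = distribution , defect-limit
  where
  distribution : ∀ n → 3 ≤ n → _
  distribution (suc m) _ =
    (countC-below , countC-top , countC-above) , totalC-defect ,
    -- The permutation has `seatingC` itself as its map from diners to seats, so its positions, and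
    -- with them its `ν`, agree with Algorithm C by computation.
    λ σ → seatingOrderC σ , (λ _ → refl) , λ (w , _) → νC-optimal σ
      (λ eq → trans (sym (inverseʳ w)) (trans (cong (w ⟨$⟩ʳ_) eq) (inverseʳ w)))
    where open Clairvoyant m
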